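{- Let $n\ge 1$. The peak algebra $\mathfrak{P}_n$ is a subalgebra of the descent algebra $\Sigma(A_{n-1})$ of the symmetric group $\mathcal{S}_n$. Moreover, $\mathfrak{P}_n=\varphi(\Sigma(B_n))=\psi(\Sigma(D_n))$.
   Context: Notation: $[m]=\{1,\dots,m\}$. $\mathcal S_n$ is the symmetric group; a permutation is written $w=w_1\cdots w_n$ with $w_i=w(i)$, and $\mathrm{Des}(w)=\{i\in[n-1]: w_i>w_{i+1}\}$. The product of $\mathbb Q\mathcal S_n$ is composition. For $J\subseteq[n-1]$, $Y_J=\sum_{w\in\mathcal S_n,\ \mathrm{Des}(w)=J}w$; the descent algebra $\Sigma(A_{n-1})$ is the (Solomon) subalgebra of $\mathbb Q\mathcal S_n$ spanned by the $Y_J$. The peak set of $w\in\mathcal S_n$ is $\mathrm{Peak}(w)=\{i\in[n-1]: w_{i-1}<w_i>w_{i+1}\}$, with the convention $w_0=0$ (so $1$ is a peak iff $w_1>w_2$). $\mathcal F_n$ is the set of subsets of $[n-1]$ containing no two consecutive integers. For $F\in\mathcal F_n$, $P_F=\sum_{\mathrm{Peak}(w)=F}w$, and $\mathfrak P_n$ is the linear span of $\{P_F\}_{F\in\mathcal F_n}$. Type B: $\mathcal B_n$ is the group of signed permutations, i.e. bijections $w$ of $\{\pm1,\dots,\pm n\}$ with $w(-i)=-w(i)$, written $w=w_1\cdots w_n$, a negative entry $-k$ written $\bar k$; product is composition. Entries are ordered $\cdots<\bar 2<\bar1<1<2<\cdots$. For $w\in\mathcal B_n$, $\mathrm{Des}(w)=\{i\in\{0,1,\dots,n-1\}: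 w_i>w_{i+1}\}$ with $w_0=0$. For $J\subseteq\{0,\dots,n-1\}$, $Y_J=\sum_{w\in\mathcal B_n,\ \mathrm{Des}(w)=J}w$, and $\Sigma(B_n)$ is the descent algebra spanned by these. $\varphi:\mathbb Q\mathcal B_n\to\mathbb Q\mathcal S_n$ is the linear extension of the homomorphism forgetting signs, $w\mapsto|w_1|\cdots|w_n|$. Type D: $\mathcal D_n\subseteq\mathcal B_n$ is the subgroup of signed permutations with an even number of negative entries. Its descent set is a subset of $\{1',1,2,\dots,n-1\}$: $w$ has a descent at $i\in[n-1]$ iff $w_i>w_{i+1}$, and a descent at $1'$ iff $-w_1>w_2$ (in the order above). $\Sigma(D_n)$ is the span of the elements $Y_J=\sum_{w\in\mathcal D_n,\ \mathrm{Des}(w)=J}w$, $J\subseteq\{1',1,\dots,n-1\}$ (Solomon's descent algebra of type $D_n$). $\psi$ is the restriction of $\varphi$ to $\mathbb Q\mathcal D_n$. -}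

module Defs where

open import Data.Bool using (Bool; true; false; if_then_else_; _xor_; not; _∧_)
import Data.Bool.Properties as BoolP
open import Data.Nat using (ℕ; zero; suc; _<ᵇ_)
open import Data.Fin using (Fin; toℕ; inject₁) renaming (zero to fz; suc to fs)
import Data.Fin.Properties as FinP
open import Data.Integer using (ℤ; +_; -[1+_]; -_)
import Data.Integer.Properties as ℤP
open import Data.Rational using (ℚ; 0ℚ; 1ℚ) renaming (_+_ to _+ℚ_; _*_ to _*ℚ_)
open import Data.List using (List; []; _∷_; map; concatMap; foldr; filter; filterᵇ; allFin)
open import Data.Vec using (Vec; []; _∷_; lookup; tabulate; toList; zipWith; allFin)
  renaming (map to vmap)
import Data.Vec.Properties as VecP
open import Data.Product using (Σ; ∃; _×_; _,_)
open import Relation.Nullary using (Dec; does; _→-dec_)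
open import Relation.Binary.PropositionalEquality using (_≡_)

allVecs : {A : Set} → (k : ℕ) → List A → List (Vec A k)
allVecs zero    xs = [] ∷ []
allVecs (suc k) xs = concatMap (λ x → map (x ∷_) (allVecs k xs)) xs

bools : List Bool
bools = true ∷ false ∷ []

subsets : (k : ℕ) → List (Vec Bool k)
subsets k = allVecs k bools

sumOver : {A : Set} → List A → (A → ℚ) → ℚ
sumOver xs f = foldr (λ x acc → f x +ℚ acc) 0ℚ xs

indicator : Bool → ℚ
indicator b = if b then 1ℚ else 0ℚ

eqBoolVec : {k : ℕ} → Vec Bool k → Vec Bool k → Bool
eqBoolVec u v = does (VecP.≡-dec BoolP._≟_ u v)

-- Symmetric group S_n: a permutation w = w_1 ⋯ w_n is stored as a word
-- Vec (Fin n) n (entry j : Fin n stands for the value toℕ j + 1),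
-- and a word is a permutation iff it is injective.

Word : ℕ → Set
Word n = Vec (Fin n) n

IsPerm : {n : ℕ} → Word n → Set
IsPerm {n} w = (i j : Fin n) → lookup w i ≡ lookup w j → i ≡ j

isPerm? : {n : ℕ} → (w : Word n) → Dec (IsPerm w)
isPerm? w = FinP.all? (λ i → FinP.all? (λ j →
              (lookup w i FinP.≟ lookup w j) →-dec (i FinP.≟ j)))

perms : (n : ℕ) → List (Word n)
perms n = filter isPerm? (allVecs n (Data.List.allFin n))

compose : {n : ℕ} → Word n → Word n → Word n
compose u v = vmap (lookup u) v

identityPerm : (n : ℕ) → Word n
identityPerm n = Data.Vec.allFin n

-- The group algebra ℚS_n: functions S_n → ℚ (coefficient of each w).
-- Elements are functions on words; only values on permutations matter.

QS : ℕ → Set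
QS n = Word n → ℚ

_≈S_ : {n : ℕ} → QS n → QS n → Set
_≈S_ {n} x y = (w : Word n) → IsPerm w → x w ≡ y w

_*S_ : {n : ℕ} → QS n → QS n → QS n
_*S_ {n} a b w =
  sumOver (perms n) (λ u → sumOver (perms n) (λ v →
    if does (VecP.≡-dec FinP._≟_ (compose u v) w) then a u *ℚ b v else 0ℚ))

oneS : (n : ℕ) → QS n
oneS n w = indicator (does (VecP.≡-dec FinP._≟_ w (identityPerm n)))

-- Descent and peak sets in S_n, n = suc m.  Subsets of [m] = [n-1] are
-- vectors Vec Bool m; index k : Fin m stands for the position k+1.

-- 0 w_1 ⋯ w_n as naturals (w_0 = 0 convention)
valsℕ : {n : ℕ} → Word n → Vec ℕ (suc n)
valsℕ w = 0 ∷ vmap (λ a → suc (toℕ a)) w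

-- descent at position k+1: w_{k+1} > w_{k+2}
desSetA : {m : ℕ} → Word (suc m) → Vec Bool m
desSetA {m} w = tabulate (λ k →
  lookup (valsℕ w) (fs (fs k)) <ᵇ lookup (valsℕ w) (fs (inject₁ k)))

-- peak at position k+1: w_k < w_{k+1} > w_{k+2}, with w_0 = 0
peakSet : {m : ℕ} → Word (suc m) → Vec Bool m
peakSet {m} w = tabulate (λ k →
  (lookup (valsℕ w) (inject₁ (inject₁ k)) <ᵇ lookup (valsℕ w) (fs (inject₁ k)))
  ∧ (lookup (valsℕ w) (fs (fs k)) <ᵇ lookup (valsℕ w) (fs (inject₁ k))))

YA : {m : ℕ} → Vec Bool m → QS (suc m)
YA J w = indicator (eqBoolVec (desSetA w) J)

PF : {m : ℕ} → Vec Bool m → QS (suc m)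
PF F w = indicator (eqBoolVec (peakSet w) F)

noConsec : {k : ℕ} → Vec Bool k → Bool
noConsec []           = true
noConsec (b ∷ [])     = true
noConsec (b ∷ c ∷ bs) = not (b ∧ c) ∧ noConsec (c ∷ bs)

peakSets : (m : ℕ) → List (Vec Bool m)
peakSets m = filterᵇ noConsec (subsets m)

InDescentAlgA : {m : ℕ} → QS (suc m) → Set
InDescentAlgA {m} x =
  Σ (Vec Bool m → ℚ) λ c → x ≈S (λ w → sumOver (subsets m) (λ J → c J *ℚ YA J w))

InPeakAlg : {m : ℕ} → QS (suc m) → Set
InPeakAlg {m} x =
  Σ (Vec Bool m → ℚ) λ d → x ≈S (λ w → sumOver (peakSets m) (λ F → d F *ℚ PF F w))

-- Signed permutations: a pair (w , s) with w a permutation (the absolute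
-- values) and s : Vec Bool n the signs (true = negative entry).

Signs : ℕ → Set
Signs n = Vec Bool n

signed : {n : ℕ} → Bool → Fin n → ℤ
signed true  a = -[1+ toℕ a ]
signed false a = + suc (toℕ a)

-- 0 w_1 ⋯ w_n as integers (w_0 = 0)
valsℤ : {n : ℕ} → Word n → Signs n → Vec ℤ (suc n)
valsℤ w s = + 0 ∷ zipWith signed s w

ltℤ : ℤ → ℤ → Bool
ltℤ a b = does (a ℤP.<? b)

evenSigns : {n : ℕ} → Signs n → Bool
evenSigns s = not (Data.Vec.foldr _ _xor_ false s)

QB : ℕ → Set
QB n = Word n → Signs n → ℚ

_≈B_ : {n : ℕ} → QB n → QB n → Set
_≈B_ {n} x y = (w : Word n) (s : Signs n) → IsPerm w → x w s ≡ y w s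

-- equality in ℚD_n (only elements of D_n matter)
_≈D_ : {n : ℕ} → QB n → QB n → Set
_≈D_ {n} x y = (w : Word n) (s : Signs n) → IsPerm w → evenSigns s ≡ true → x w s ≡ y w s

-- type B descent set ⊆ {0,…,n-1}; index j : Fin n stands for position j
desSetB : {n : ℕ} → Word n → Signs n → Vec Bool n
desSetB w s = tabulate (λ j → ltℤ (lookup (valsℤ w s) (fs j)) (lookup (valsℤ w s) (inject₁ j)))

-- descent at 1' : -w_1 > w_2 (impossible when n = 1)
desOnePrime : List ℤ → Bool
desOnePrime (a ∷ b ∷ _) = ltℤ b (- a)
desOnePrime _           = false

-- type D descent set ⊆ {1',1,…,n-1}; index 0 stands for 1', index k+1 for k+1
desSetD : {m : ℕ} → Word (suc m) → Signs (suc m) → Vec Bool (suc m)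
desSetD {m} w s = desOnePrime (toList (zipWith signed s w)) ∷ tabulate (λ k →
  ltℤ (lookup (valsℤ w s) (fs (fs k))) (lookup (valsℤ w s) (fs (inject₁ k))))

YB : {n : ℕ} → Vec Bool n → QB n
YB J w s = indicator (eqBoolVec (desSetB w s) J)

YD : {m : ℕ} → Vec Bool (suc m) → QB (suc m)
YD J w s = indicator (evenSigns s ∧ eqBoolVec (desSetD w s) J)

InDescentAlgB : {n : ℕ} → QB n → Set
InDescentAlgB {n} y =
  Σ (Vec Bool n → ℚ) λ c → y ≈B (λ w s → sumOver (subsets n) (λ J → c J *ℚ YB J w s))

InDescentAlgD : {m : ℕ} → QB (suc m) → Set
InDescentAlgD {m} y =
  Σ (Vec Bool (suc m) → ℚ) λ c →
    y ≈D (λ w s → sumOver (subsets (suc m)) (λ J → c J *ℚ YD J w s))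

-- φ : ℚB_n → ℚS_n forgetting signs
φ : {n : ℕ} → QB n → QS n
φ {n} y w = sumOver (subsets n) (λ s → y w s)

-- ψ : ℚD_n → ℚS_n, restriction of φ
ψ : {n : ℕ} → QB n → QS n
ψ {n} y w = sumOver (filterᵇ evenSigns (subsets n)) (λ s → y w s)

{-# OPTIONS --safe #-}
module Submission where

-- The peak set of w is a function of its descent set, which gives the
-- inclusion in the descent algebra of type A.
--
-- For the images of types B and D, fix a permutation w.  The descent at i of
-- a signing of w is determined by one sign: that of w_(i+1) if w ascends at
-- i, that of w_i if it descends.  Hence the descent set J of the signing
-- determines the sign at each letter other than a valley, a valley has a
-- free sign, and each peak i requires exactly one of i-1, i to lie in J.  As
-- there are as many valleys as peaks, summing c(J) over all signings gives
-- 2^|F| times the sum of c(J) over the J that change membership at every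
-- element of F = Peak(w); this depends on F only, and every function of F is
-- obtained, by Möbius inversion.  In type D the sign of the first letter is
-- used to correct the parity.
--
-- For closure under multiplication, exchange the values a and a+1 in w.
-- This preserves the peak set if the two values are not adjacent, and also
-- if they are the two smallest values and do not stand at the first two
-- positions.  These moves connect any two permutations with the same peak
-- set, so the peak algebra consists of the functions invariant under them;
-- and the moves on w = u v lift to moves on u or on v.

open import Defs
open import Data.Bool using (Bool; true; false; if_then_else_; _xor_; not; _∧_; T; T?)
import Data.Bool.Properties as BoolP
open import Data.Empty using (⊥-elim)
open import Data.Fin using (Fin; toℕ; inject₁; fromℕ<; punchOut) renaming (zero to fz; suc to fs)
import Data.Fin.Properties as FinP
open import Data.Integer using (+_; -_)
open import Data.List as List using (List; []; _∷_; _++_; map; concatMap; filter; filterᵇ; allFin)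
import Data.List.Properties as ListP
open import Data.List.Membership.Propositional using (_∈_; find; lose)
open import Data.List.Membership.Propositional.Properties
  using (∈-allFin; ∈-concatMap⁺; ∈-filter⁺; ∈-filter⁻; ∈-map⁺)
open import Data.List.Relation.Unary.Any using (Any; any?; here)
open import Data.Nat using (ℕ; zero; suc; _<ᵇ_; _<_; _≤_; s≤s; z≤n; _+_; _∸_)
import Data.Nat.Properties as ℕP
open import Data.Product using (Σ; _×_; _,_; proj₁; proj₂)
open import Data.Rational using (ℚ; 0ℚ; 1ℚ; ½)
  renaming (_+_ to _+ℚ_; _*_ to _*ℚ_; _-_ to _-ℚ_)
import Data.Rational.Properties as ℚP
open import Data.Rational.Solver using (module +-*-Solver)
open import Data.Sum using (_⊎_; inj₁; inj₂; [_,_])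
open import Data.Vec using (Vec; []; _∷_; head; lookup; tabulate; zipWith)
  renaming (map to vmap)
import Data.Vec.Properties as VecP
open import Function using (_∘_; id; mk⇔)
open import Function.Bundles using (_⇔_)
open import Relation.Binary.PropositionalEquality hiding ([_])
open import Relation.Nullary using (Dec; yes; no; does; ¬_; _×-dec_; _⊎-dec_; _→-dec_)
open import Relation.Nullary.Decidable using (dec-true; dec-false; decidable-stable)
open import Relation.Unary using (Decidable)
open ≡-Reasoning

private variable
  A B : Set
  k m n : ℕ

-- Sums

sumOver-cong : (xs : List A) {f g : A → ℚ} → (∀ x → f x ≡ g x) → sumOver xs f ≡ sumOver xs g
sumOver-cong []       eq = refl
sumOver-cong (x ∷ xs) eq = cong₂ _+ℚ_ (eq x) (sumOver-cong xs eq)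

+ℚ-interchange : ∀ a b c d → (a +ℚ b) +ℚ (c +ℚ d) ≡ (a +ℚ c) +ℚ (b +ℚ d)
+ℚ-interchange = solve 4 (λ a b c d → (a :+ b) :+ (c :+ d) := (a :+ c) :+ (b :+ d)) refl
  where open +-*-Solver

sumOver-+ : (xs : List A) (f g : A → ℚ) →
  sumOver xs (λ x → f x +ℚ g x) ≡ sumOver xs f +ℚ sumOver xs g
sumOver-+ []       f g = refl
sumOver-+ (x ∷ xs) f g = begin
  (f x +ℚ g x) +ℚ sumOver xs (λ x → f x +ℚ g x)     ≡⟨ cong ((f x +ℚ g x) +ℚ_) (sumOver-+ xs f g) ⟩
  (f x +ℚ g x) +ℚ (sumOver xs f +ℚ sumOver xs g)    ≡⟨ +ℚ-interchange (f x) (g x) _ _ ⟩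
  (f x +ℚ sumOver xs f) +ℚ (g x +ℚ sumOver xs g)    ∎

sumOver-if : (xs : List A) (b : A → Bool) (f : A → ℚ) →
  sumOver xs f ≡
  sumOver xs (λ x → if b x then f x else 0ℚ) +ℚ sumOver xs (λ x → if b x then 0ℚ else f x)
sumOver-if xs b f = trans (sumOver-cong xs λ x → sym (split (b x) (f x)))
  (sumOver-+ xs (λ x → if b x then f x else 0ℚ) (λ x → if b x then 0ℚ else f x))
  where
  split : ∀ b q → (if b then q else 0ℚ) +ℚ (if b then 0ℚ else q) ≡ q
  split true  q = ℚP.+-identityʳ q
  split false q = ℚP.+-identityˡ q

sumOver-++ : (xs ys : List A) (f : A → ℚ) → sumOver (xs ++ ys) f ≡ sumOver xs f +ℚ sumOver ys f
sumOver-++ []       ys f = sym (ℚP.+-identityˡ _)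
sumOver-++ (x ∷ xs) ys f =
  trans (cong (f x +ℚ_) (sumOver-++ xs ys f)) (sym (ℚP.+-assoc (f x) (sumOver xs f) (sumOver ys f)))

sumOver-map : (g : A → B) (xs : List A) (f : B → ℚ) → sumOver (map g xs) f ≡ sumOver xs (f ∘ g)
sumOver-map g []       f = refl
sumOver-map g (x ∷ xs) f = cong (f (g x) +ℚ_) (sumOver-map g xs f)

sumOver-concatMap : (g : A → List B) (xs : List A) (f : B → ℚ) →
  sumOver (concatMap g xs) f ≡ sumOver xs (λ x → sumOver (g x) f)
sumOver-concatMap g []       f = refl
sumOver-concatMap g (x ∷ xs) f =
  trans (sumOver-++ (g x) (concatMap g xs) f) (cong (sumOver (g x) f +ℚ_) (sumOver-concatMap g xs f))

sumOver-allVecs : (k : ℕ) (xs : List A) (f : Vec A (suc k) → ℚ) →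
  sumOver (allVecs (suc k) xs) f ≡ sumOver xs (λ x → sumOver (allVecs k xs) (f ∘ (x ∷_)))
sumOver-allVecs k xs f =
  trans (sumOver-concatMap _ xs f) (sumOver-cong xs λ x → sumOver-map (x ∷_) (allVecs k xs) f)

sumOver-filter : {P : A → Set} (P? : Decidable P) (xs : List A) (f : A → ℚ) →
  sumOver (filter P? xs) f ≡ sumOver xs (λ x → if does (P? x) then f x else 0ℚ)
sumOver-filter P? []       f = refl
sumOver-filter P? (x ∷ xs) f with does (P? x)
... | true  = cong (f x +ℚ_) (sumOver-filter P? xs f)
... | false = trans (sumOver-filter P? xs f) (sym (ℚP.+-identityˡ _))

sumOver-filter-cong : {P : A → Set} (P? : Decidable P) (xs : List A) {f g : A → ℚ} →
  (∀ x → P x → f x ≡ g x) → sumOver (filter P? xs) f ≡ sumOver (filter P? xs) g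
sumOver-filter-cong P? []       eq = refl
sumOver-filter-cong P? (x ∷ xs) eq with P? x
... | yes p = cong₂ _+ℚ_ (eq x p) (sumOver-filter-cong P? xs eq)
... | no _  = sumOver-filter-cong P? xs eq

-- The sum over `subsets k` in a form that splits off the first sign by computation, as the
-- recursions along descent sets require.
Σ± : (k : ℕ) → (Vec Bool k → ℚ) → ℚ
Σ± zero    f = f []
Σ± (suc k) f = Σ± k (f ∘ (true ∷_)) +ℚ Σ± k (f ∘ (false ∷_))

Σ±-cong : (k : ℕ) {f g : Vec Bool k → ℚ} → (∀ s → f s ≡ g s) → Σ± k f ≡ Σ± k g
Σ±-cong zero    eq = eq []
Σ±-cong (suc k) eq = cong₂ _+ℚ_ (Σ±-cong k (eq ∘ (true ∷_))) (Σ±-cong k (eq ∘ (false ∷_)))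

sumOver-subsets : (k : ℕ) (f : Vec Bool k → ℚ) → sumOver (subsets k) f ≡ Σ± k f
sumOver-subsets zero    f = ℚP.+-identityʳ (f [])
sumOver-subsets (suc k) f = begin
  sumOver (subsets (suc k)) f
    ≡⟨ sumOver-allVecs k bools f ⟩
  sumOver (subsets k) (f ∘ (true ∷_)) +ℚ (sumOver (subsets k) (f ∘ (false ∷_)) +ℚ 0ℚ)
    ≡⟨ cong (sumOver (subsets k) (f ∘ (true ∷_)) +ℚ_) (ℚP.+-identityʳ _) ⟩
  sumOver (subsets k) (f ∘ (true ∷_)) +ℚ sumOver (subsets k) (f ∘ (false ∷_))
    ≡⟨ cong₂ _+ℚ_ (sumOver-subsets k _) (sumOver-subsets k _) ⟩
  Σ± (suc k) f ∎

Σ±-zero : (k : ℕ) {f : Vec Bool k → ℚ} → (∀ s → f s ≡ 0ℚ) → Σ± k f ≡ 0ℚ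
Σ±-zero zero    eq = eq []
Σ±-zero (suc k) eq = cong₂ _+ℚ_ (Σ±-zero k (eq ∘ (true ∷_))) (Σ±-zero k (eq ∘ (false ∷_)))

Σ±-single : (v : Vec Bool k) (f : Vec Bool k → ℚ) → (∀ s → v ≢ s → f s ≡ 0ℚ) → Σ± k f ≡ f v
Σ±-single []          f zer = refl
Σ±-single {suc k} (true ∷ v) f zer = begin
  Σ± k (f ∘ (true ∷_)) +ℚ Σ± k (f ∘ (false ∷_))
    ≡⟨ cong₂ _+ℚ_ (Σ±-single v _ λ s v≢s → zer _ (v≢s ∘ VecP.∷-injectiveʳ))
                  (Σ±-zero k λ s → zer _ λ ()) ⟩
  f (true ∷ v) +ℚ 0ℚ ≡⟨ ℚP.+-identityʳ _ ⟩
  f (true ∷ v) ∎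
Σ±-single {suc k} (false ∷ v) f zer = begin
  Σ± k (f ∘ (true ∷_)) +ℚ Σ± k (f ∘ (false ∷_))
    ≡⟨ cong₂ _+ℚ_ (Σ±-zero k λ s → zer _ λ ())
                  (Σ±-single v _ λ s v≢s → zer _ (v≢s ∘ VecP.∷-injectiveʳ)) ⟩
  0ℚ +ℚ f (false ∷ v) ≡⟨ ℚP.+-identityˡ _ ⟩
  f (false ∷ v) ∎

-- Only the summand with `J` equal to `v` survives. With `v` a descent set, this turns linear
-- combinations of basis elements into arbitrary functions of the descent set.
sum-indicator : (v : Vec Bool k) (g : Vec Bool k → ℚ) →
  sumOver (subsets k) (λ J → g J *ℚ indicator (eqBoolVec v J)) ≡ g v
sum-indicator {k} v g = begin
  sumOver (subsets k) (λ J → g J *ℚ indicator (eqBoolVec v J))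
    ≡⟨ sumOver-subsets k _ ⟩
  Σ± k (λ J → g J *ℚ indicator (eqBoolVec v J))
    ≡⟨ Σ±-single v _ (λ J v≢J → trans
         (cong (λ b → g J *ℚ indicator b) (dec-false (VecP.≡-dec BoolP._≟_ v J) v≢J))
         (ℚP.*-zeroʳ (g J))) ⟩
  g v *ℚ indicator (eqBoolVec v v)
    ≡⟨ cong (λ b → g v *ℚ indicator b) (dec-true (VecP.≡-dec BoolP._≟_ v v) refl) ⟩
  g v *ℚ 1ℚ
    ≡⟨ ℚP.*-identityʳ (g v) ⟩
  g v ∎

-- The sum over the sign vectors with an odd (p = true) or even (p = false)
-- number of minus signs.
Σ±ₚ : Bool → (k : ℕ) → (Vec Bool k → ℚ) → ℚ
Σ±ₚ p zero    f = if p then 0ℚ else f []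
Σ±ₚ p (suc k) f = Σ±ₚ (not p) k (f ∘ (true ∷_)) +ℚ Σ±ₚ p k (f ∘ (false ∷_))

Σ±ₚ-cong : (p : Bool) (k : ℕ) {f g : Vec Bool k → ℚ} → (∀ s → f s ≡ g s) → Σ±ₚ p k f ≡ Σ±ₚ p k g
Σ±ₚ-cong true  zero    eq = refl
Σ±ₚ-cong false zero    eq = eq []
Σ±ₚ-cong p     (suc k) eq =
  cong₂ _+ℚ_ (Σ±ₚ-cong (not p) k (eq ∘ (true ∷_))) (Σ±ₚ-cong p k (eq ∘ (false ∷_)))

Σ±ₚ-+ : (p : Bool) (k : ℕ) (f : Vec Bool k → ℚ) → Σ±ₚ (not p) k f +ℚ Σ±ₚ p k f ≡ Σ± k f
Σ±ₚ-+ true  zero    f = ℚP.+-identityʳ (f [])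
Σ±ₚ-+ false zero    f = ℚP.+-identityˡ (f [])
Σ±ₚ-+ p     (suc k) f = begin
  (Σ±ₚ (not (not p)) k f₁ +ℚ Σ±ₚ (not p) k f₀) +ℚ (Σ±ₚ (not p) k f₁ +ℚ Σ±ₚ p k f₀)
    ≡⟨ +ℚ-interchange (Σ±ₚ (not (not p)) k f₁) _ _ _ ⟩
  (Σ±ₚ (not (not p)) k f₁ +ℚ Σ±ₚ (not p) k f₁) +ℚ (Σ±ₚ (not p) k f₀ +ℚ Σ±ₚ p k f₀)
    ≡⟨ cong₂ _+ℚ_ (Σ±ₚ-+ (not p) k f₁) (Σ±ₚ-+ p k f₀) ⟩
  Σ± k f₁ +ℚ Σ± k f₀ ∎
  where
  f₁ = f ∘ (true ∷_)
  f₀ = f ∘ (false ∷_)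

parity : Vec Bool k → Bool
parity = Data.Vec.foldr _ _xor_ false

Σ±-parity : (p : Bool) (k : ℕ) (f : Vec Bool k → ℚ) →
  Σ± k (λ s → if not (p xor parity s) then f s else 0ℚ) ≡ Σ±ₚ p k f
Σ±-parity true  zero    f = refl
Σ±-parity false zero    f = refl
Σ±-parity p     (suc k) f = cong₂ _+ℚ_
  (trans (Σ±-cong k λ s → cong (λ b → if not b then f (true ∷ s) else 0ℚ) (flip p (parity s)))
         (Σ±-parity (not p) k _))
  (Σ±-parity p k _)
  where
  flip : ∀ p q → p xor not q ≡ not p xor q
  flip true  q = BoolP.not-involutive q
  flip false q = refl

sumOver-evenSigns : (k : ℕ) (f : Vec Bool k → ℚ) →
  sumOver (filterᵇ evenSigns (subsets k)) f ≡ Σ±ₚ false k f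
sumOver-evenSigns k f = begin
  sumOver (filterᵇ evenSigns (subsets k)) f                        ≡⟨ sumOver-filter (T? ∘ evenSigns) (subsets k) f ⟩
  sumOver (subsets k) (λ s → if evenSigns s then f s else 0ℚ)      ≡⟨ sumOver-subsets k _ ⟩
  Σ± k (λ s → if evenSigns s then f s else 0ℚ)                     ≡⟨ Σ±-parity false k f ⟩
  Σ±ₚ false k f ∎

-- Peak sets and descent sets

-- peaks d J is the peak set of a word with descent set J, where d tells
-- whether the word is preceded by a descent.
peaks : Bool → Vec Bool k → Vec Bool k
peaks d []       = []
peaks d (b ∷ bs) = not d ∧ b ∷ peaks b bs

peaks-noConsec : (d : Bool) (bs : Vec Bool k) → noConsec (peaks d bs) ≡ true
peaks-noConsec d []           = refl
peaks-noConsec d (b ∷ [])     = refl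
peaks-noConsec d (b ∷ c ∷ bs) = cong₂ _∧_ (lem d b c) (peaks-noConsec b (c ∷ bs))
  where
  lem : ∀ d b c → not ((not d ∧ b) ∧ (not b ∧ c)) ≡ true
  lem true  b     c = refl
  lem false true  c = refl
  lem false false c = refl

not-<ᵇ : ∀ {a b} → a ≢ b → (a <ᵇ b) ≡ not (b <ᵇ a)
not-<ᵇ {zero}  {zero}  a≢b = ⊥-elim (a≢b refl)
not-<ᵇ {zero}  {suc b} a≢b = refl
not-<ᵇ {suc a} {zero}  a≢b = refl
not-<ᵇ {suc a} {suc b} a≢b = not-<ᵇ (a≢b ∘ cong suc)

-- As neighbouring values differ, an ascent on the left of a position is the absence of a descent
-- there, so two consecutive descent tests decide each peak.
peaks-tabulate : (g : Fin (suc (suc m)) → ℕ) → (∀ i → g (inject₁ i) ≢ g (fs i)) →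
  tabulate (λ k → (g (inject₁ (inject₁ k)) <ᵇ g (fs (inject₁ k))) ∧ (g (fs (fs k)) <ᵇ g (fs (inject₁ k))))
  ≡ peaks (g (fs fz) <ᵇ g fz) (tabulate λ k → g (fs (fs k)) <ᵇ g (fs (inject₁ k)))
peaks-tabulate {zero}  g neq = refl
peaks-tabulate {suc m} g neq =
  cong₂ _∷_ (cong₂ _∧_ (not-<ᵇ (neq fz)) refl) (peaks-tabulate (g ∘ fs) (neq ∘ fs))

value : Word n → Fin n → ℕ
value w i = toℕ (lookup w i)

value-injective : (w : Word n) → IsPerm w → ∀ {i j} → value w i ≡ value w j → i ≡ j
value-injective w p = p _ _ ∘ FinP.toℕ-injective

inject₁≢suc : (i : Fin n) → inject₁ i ≢ fs i
inject₁≢suc fz     ()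
inject₁≢suc (fs i) eq = inject₁≢suc i (FinP.suc-injective eq)

lookup-vals : (w : Word n) (i : Fin n) → lookup (vmap (suc ∘ toℕ) w) i ≡ suc (value w i)
lookup-vals w i = VecP.lookup-map i (suc ∘ toℕ) w

peakSet≡peaks : (w : Word (suc m)) → IsPerm w → peakSet w ≡ peaks false (desSetA w)
peakSet≡peaks w p = trans (peaks-tabulate (lookup (valsℕ w)) neq) (cong (λ b → peaks b (desSetA w)) (first w))
  where
  neq : ∀ i → lookup (valsℕ w) (inject₁ i) ≢ lookup (valsℕ w) (fs i)
  neq fz     eq with () ← trans eq (lookup-vals w fz)
  neq (fs i) eq = inject₁≢suc i (value-injective w p (ℕP.suc-injective
    (trans (sym (lookup-vals w (inject₁ i))) (trans eq (lookup-vals w (fs i))))))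
  first : ∀ {m} (w : Word (suc m)) → (lookup (valsℕ w) (fs fz) <ᵇ 0) ≡ false
  first (a ∷ w) = refl

peakSet-noConsec : (w : Word (suc m)) → IsPerm w → noConsec (peakSet w) ≡ true
peakSet-noConsec w p = trans (cong noConsec (peakSet≡peaks w p)) (peaks-noConsec false (desSetA w))

sum-YA : (c : Vec Bool m → ℚ) (w : Word (suc m)) →
  sumOver (subsets m) (λ J → c J *ℚ YA J w) ≡ c (desSetA w)
sum-YA c w = sum-indicator (desSetA w) c

sum-PF : (d : Vec Bool m → ℚ) (w : Word (suc m)) → IsPerm w →
  sumOver (peakSets m) (λ F → d F *ℚ PF F w) ≡ d (peakSet w)
sum-PF {m} d w p = begin
  sumOver (peakSets m) (λ F → d F *ℚ PF F w)
    ≡⟨ sumOver-filter (T? ∘ noConsec) (subsets m) _ ⟩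
  sumOver (subsets m) (λ F → if noConsec F then d F *ℚ PF F w else 0ℚ)
    ≡⟨ sumOver-cong (subsets m) (λ F → pull (noConsec F) (d F) (PF F w)) ⟩
  sumOver (subsets m) (λ F → d′ F *ℚ PF F w)
    ≡⟨ sum-indicator (peakSet w) d′ ⟩
  d′ (peakSet w)
    ≡⟨ cong (λ b → if b then d (peakSet w) else 0ℚ) (peakSet-noConsec w p) ⟩
  d (peakSet w) ∎
  where
  -- Extending `d` by zero lets the sum run over all subsets; peak sets never meet the zero part.
  d′ : Vec Bool m → ℚ
  d′ F = if noConsec F then d F else 0ℚ
  pull : ∀ b x y → (if b then x *ℚ y else 0ℚ) ≡ (if b then x else 0ℚ) *ℚ y
  pull true  x y = refl
  pull false x y = sym (ℚP.*-zeroˡ y)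

peakAlg-intro : (x : QS (suc m)) (d : Vec Bool m → ℚ) →
  (∀ w → IsPerm w → x w ≡ d (peakSet w)) → InPeakAlg x
peakAlg-intro x d eq = d , λ w p → trans (eq w p) (sym (sum-PF d w p))

peakAlg-elim : (x : QS (suc m)) ((d , _) : InPeakAlg x) → ∀ w → IsPerm w → x w ≡ d (peakSet w)
peakAlg-elim x (d , eq) w p = trans (eq w p) (sum-PF d w p)

peakAlg⊆descentAlg : (x : QS (suc m)) → InPeakAlg x → InDescentAlgA x
peakAlg⊆descentAlg x x∈P@(d , _) = (d ∘ peaks false) , λ w p → begin
  x w                              ≡⟨ peakAlg-elim x x∈P w p ⟩
  d (peakSet w)                    ≡⟨ cong d (peakSet≡peaks w p) ⟩
  d (peaks false (desSetA w))      ≡⟨ sum-YA (d ∘ peaks false) w ⟨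
  sumOver (subsets _) (λ J → d (peaks false J) *ℚ YA J w) ∎

-- The images of the descent algebras of types B and D

-- The descent set, without position 0, of a signed permutation: ds is the
-- descent set of the underlying permutation, s ∷ ss are the signs.
signedDescents : Bool → Vec Bool k → Vec Bool k → Vec Bool k
signedDescents s []       []       = []
signedDescents s (d ∷ ds) (t ∷ ss) = (if d then not s else t) ∷ signedDescents t ds ss

if-true-false : ∀ c → c ≡ (if c then true else false)
if-true-false true  = refl
if-true-false false = refl

-- The letter of larger absolute value decides: there is a descent if it is the first and positive,
-- or the second and negative.
ltℤ-signed : {a b : Fin n} (s t : Bool) → a ≢ b →
  ltℤ (signed t b) (signed s a) ≡ (if toℕ b <ᵇ toℕ a then not s else t)
ltℤ-signed {a = a} {b} false true  a≢b = sym (BoolP.if-eta (toℕ b <ᵇ toℕ a))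
ltℤ-signed {a = a} {b} true  false a≢b = sym (BoolP.if-eta (toℕ b <ᵇ toℕ a))
ltℤ-signed {a = a} {b} false false a≢b = if-true-false (toℕ b <ᵇ toℕ a)
ltℤ-signed {a = a} {b} true  true  a≢b =
  trans (not-<ᵇ (a≢b ∘ FinP.toℕ-injective)) (if-false-true (toℕ b <ᵇ toℕ a))
  where
  if-false-true : ∀ c → not c ≡ (if c then false else true)
  if-false-true true  = refl
  if-false-true false = refl

neg-signed : (s : Bool) (a : Fin n) → - signed s a ≡ signed (not s) a
neg-signed true  a = refl
neg-signed false a = refl

tabulate-signed : (s : Bool) (ss : Vec Bool k) (w : Vec (Fin n) (suc k)) →
  (∀ i → lookup w (inject₁ i) ≢ lookup w (fs i)) →
  tabulate (λ j → ltℤ (lookup (zipWith signed (s ∷ ss) w) (fs j)) (lookup (zipWith signed (s ∷ ss) w) (inject₁ j)))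
  ≡ signedDescents s (tabulate λ j → lookup (vmap (suc ∘ toℕ) w) (fs j) <ᵇ lookup (vmap (suc ∘ toℕ) w) (inject₁ j)) ss
tabulate-signed s []       (a ∷ [])    neq = refl
tabulate-signed s (t ∷ ss) (a ∷ b ∷ w) neq =
  cong₂ _∷_ (ltℤ-signed s t (neq fz)) (tabulate-signed t ss (b ∷ w) (neq ∘ fs))

adjacent-distinct : (w : Word (suc m)) → IsPerm w → ∀ i → lookup w (inject₁ i) ≢ lookup w (fs i)
adjacent-distinct w p i = inject₁≢suc i ∘ p _ _

desSetB≡ : (w : Word (suc m)) (s : Bool) (ss : Vec Bool m) → IsPerm w →
  desSetB w (s ∷ ss) ≡ s ∷ signedDescents s (desSetA w) ss
desSetB≡ w@(a ∷ _) s ss p = cong₂ _∷_ (first s) (tabulate-signed s ss w (adjacent-distinct w p))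
  where
  first : ∀ s → ltℤ (signed s a) (+ 0) ≡ s
  first true  = refl
  first false = refl

-- A descent at 1′ is a descent at 1 after the first sign is changed; hence the rule of
-- `signedDescents` with `s` in place of `not s`.
signedDescentsD : Vec Bool (suc k) → Vec Bool (suc (suc k)) → Vec Bool (suc (suc k))
signedDescentsD ds (s ∷ t ∷ ss) = (if head ds then s else t) ∷ signedDescents s ds (t ∷ ss)

desSetD≡ : (w : Word (suc (suc m))) (s : Signs (suc (suc m))) → IsPerm w →
  desSetD w s ≡ signedDescentsD (desSetA w) s
desSetD≡ w@(a ∷ b ∷ _) (s ∷ t ∷ ss) p = cong₂ _∷_ first (tabulate-signed s (t ∷ ss) w (adjacent-distinct w p))
  where
  first : ltℤ (signed t b) (- signed s a) ≡ (if toℕ b <ᵇ toℕ a then s else t)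
  first = begin
    ltℤ (signed t b) (- signed s a)                  ≡⟨ cong (ltℤ (signed t b)) (neg-signed s a) ⟩
    ltℤ (signed t b) (signed (not s) a)              ≡⟨ ltℤ-signed (not s) t (adjacent-distinct w p fz) ⟩
    (if toℕ b <ᵇ toℕ a then not (not s) else t)      ≡⟨ cong (λ u → if toℕ b <ᵇ toℕ a then u else t) (BoolP.not-involutive s) ⟩
    (if toℕ b <ᵇ toℕ a then s else t)                ∎

-- peakSumB F c is the value at a permutation with peak set F of the image
-- under φ of Σ_J c(J) Y_J.  peakSumV F c is half of its analogue for suffixes
-- that follow a descent, over both signs of the letter before the suffix;
-- such a suffix does not start with a peak.
peakSumB : Vec Bool k → (Vec Bool (suc k) → ℚ) → ℚ
peakSumV : Vec Bool k → (Vec Bool k → ℚ) → ℚ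

peakSumB []          c = c (true ∷ []) +ℚ c (false ∷ [])
peakSumB (false ∷ F) c = peakSumB F (c ∘ (true ∷_)) +ℚ peakSumB F (c ∘ (false ∷_))
peakSumB (true ∷ F)  c = half +ℚ half
  where half = peakSumV F (λ J → c (true ∷ false ∷ J)) +ℚ peakSumV F (λ J → c (false ∷ true ∷ J))

peakSumV []      c = c []
peakSumV (_ ∷ F) c = peakSumB F c

-- A set `peaks true ds` is empty or begins with a non-peak, and in both cases `peakSumB` adds over
-- the first membership.
peakSumV-split : (ds : Vec Bool k) (c : Vec Bool (suc k) → ℚ) →
  peakSumV (peaks true ds) (c ∘ (true ∷_)) +ℚ peakSumV (peaks true ds) (c ∘ (false ∷_))
  ≡ peakSumB (peaks true ds) c
peakSumV-split []       c = refl
peakSumV-split (d ∷ ds) c = refl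

-- Induction along the word. At an ascent the next sign is itself the next membership, so the same
-- situation recurs. At a descent, here a peak, the current sign fixes two opposite memberships, and
-- what remains is a suffix after a descent.
sum-signedDescents : (ds : Vec Bool k) (c : Vec Bool (suc k) → ℚ) →
  Σ± k (λ ss → c (true ∷ signedDescents true ds ss)) +ℚ
  Σ± k (λ ss → c (false ∷ signedDescents false ds ss))
  ≡ peakSumB (peaks false ds) c

-- Once the descent at the boundary is fixed, the two signs of the last letter
-- before the suffix are distinguished by parity alone.
sumₚ-signedDescents : (p : Bool) (ds : Vec Bool k) (c : Vec Bool k → ℚ) →
  Σ±ₚ (not p) k (λ ss → c (signedDescents true ds ss)) +ℚ
  Σ±ₚ p k (λ ss → c (signedDescents false ds ss))
  ≡ peakSumV (peaks true ds) c

-- The terms are grouped by the parity of all signs involved, that of the letter before the suffix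
-- included. Both classes have the same sum; this doubling is the free sign of the valley at the end
-- of the run.
sum-signedDescents-after-descent : (ds : Vec Bool k) (c : Vec Bool k → ℚ) →
  Σ± k (λ ss → c (signedDescents true ds ss)) +ℚ Σ± k (λ ss → c (signedDescents false ds ss))
  ≡ peakSumV (peaks true ds) c +ℚ peakSumV (peaks true ds) c
sum-signedDescents-after-descent {k} ds c = begin
  Σ± k f₁ +ℚ Σ± k f₀
    ≡⟨ cong₂ _+ℚ_ (Σ±ₚ-+ true k f₁) (Σ±ₚ-+ false k f₀) ⟨
  (Σ±ₚ false k f₁ +ℚ Σ±ₚ true k f₁) +ℚ (Σ±ₚ true k f₀ +ℚ Σ±ₚ false k f₀)
    ≡⟨ +ℚ-interchange (Σ±ₚ false k f₁) _ _ _ ⟩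
  (Σ±ₚ false k f₁ +ℚ Σ±ₚ true k f₀) +ℚ (Σ±ₚ true k f₁ +ℚ Σ±ₚ false k f₀)
    ≡⟨ cong₂ _+ℚ_ (sumₚ-signedDescents true ds c) (sumₚ-signedDescents false ds c) ⟩
  peakSumV (peaks true ds) c +ℚ peakSumV (peaks true ds) c ∎
  where
  f₁ = λ ss → c (signedDescents true ds ss)
  f₀ = λ ss → c (signedDescents false ds ss)

sum-signedDescents []           c = refl
sum-signedDescents (false ∷ ds) c =
  cong₂ _+ℚ_ (sum-signedDescents ds (c ∘ (true ∷_))) (sum-signedDescents ds (c ∘ (false ∷_)))
sum-signedDescents (true ∷ ds)  c = trans
  (cong₂ _+ℚ_ (sum-signedDescents-after-descent ds (λ J → c (true ∷ false ∷ J)))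
              (sum-signedDescents-after-descent ds (λ J → c (false ∷ true ∷ J))))
  (+ℚ-interchange (peakSumV (peaks true ds) _) _ _ _)

sumₚ-signedDescents true  [] c = ℚP.+-identityʳ (c [])
sumₚ-signedDescents false [] c = ℚP.+-identityˡ (c [])
-- After an ascent the sign of the earlier letter no longer enters, so the two parity classes sum
-- one function and together exhaust all signs.
sumₚ-signedDescents {suc k} p (false ∷ ds) c =
  trans (Σ±ₚ-+ p (suc k) (λ ss → c (signedDescents true (false ∷ ds) ss))) (sum-signedDescents ds c)
-- The descent fixes the next membership to the opposite of the earlier sign, and the parity
-- condition passes to the next letter.
sumₚ-signedDescents p (true ∷ ds) c = begin
  _ ≡⟨ cong₂ _+ℚ_ (sumₚ-signedDescents (not p) ds (c ∘ (false ∷_)))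
                  (sumₚ-signedDescents p ds (c ∘ (true ∷_))) ⟩
  peakSumV (peaks true ds) (c ∘ (false ∷_)) +ℚ peakSumV (peaks true ds) (c ∘ (true ∷_))
    ≡⟨ ℚP.+-comm (peakSumV (peaks true ds) (c ∘ (false ∷_))) _ ⟩
  peakSumV (peaks true ds) (c ∘ (true ∷_)) +ℚ peakSumV (peaks true ds) (c ∘ (false ∷_))
    ≡⟨ peakSumV-split ds c ⟩
  peakSumB (peaks true ds) c ∎

φ-descent : (c : Vec Bool (suc m) → ℚ) (w : Word (suc m)) → IsPerm w →
  φ (λ w s → c (desSetB w s)) w ≡ peakSumB (peakSet w) c
φ-descent {m} c w p = begin
  sumOver (subsets (suc m)) (λ s → c (desSetB w s))
    ≡⟨ sumOver-subsets (suc m) (λ s → c (desSetB w s)) ⟩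
  Σ± m (λ ss → c (desSetB w (true ∷ ss))) +ℚ Σ± m (λ ss → c (desSetB w (false ∷ ss)))
    ≡⟨ cong₂ _+ℚ_ (Σ±-cong m λ ss → cong c (desSetB≡ w true ss p))
                  (Σ±-cong m λ ss → cong c (desSetB≡ w false ss p)) ⟩
  Σ± m (λ ss → c (true ∷ signedDescents true (desSetA w) ss)) +ℚ
  Σ± m (λ ss → c (false ∷ signedDescents false (desSetA w) ss))
    ≡⟨ sum-signedDescents (desSetA w) c ⟩
  peakSumB (peaks false (desSetA w)) c
    ≡⟨ cong (λ F → peakSumB F c) (peakSet≡peaks w p) ⟨
  peakSumB (peakSet w) c ∎

-- Without a descent at 1, the memberships of 1′ and 1 both equal the second sign, and the first
-- sign only corrects the parity. With one, exactly one of 1′ and 1 is a descent, as around a peak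
-- in type B, but the parity condition removes the doubling.
peakSumD : Vec Bool (suc k) → (Vec Bool (suc (suc k)) → ℚ) → ℚ
peakSumD (false ∷ F) c = peakSumB F (λ J → c (head J ∷ J))
peakSumD (true ∷ F)  c =
  peakSumV F (λ J → c (true ∷ false ∷ J)) +ℚ peakSumV F (λ J → c (false ∷ true ∷ J))

sum-signedDescentsD : (ds : Vec Bool (suc k)) (c : Vec Bool (suc (suc k)) → ℚ) →
  Σ±ₚ false (suc (suc k)) (λ s → c (signedDescentsD ds s))
  ≡ peakSumD (peaks false ds) c
sum-signedDescentsD {k} (false ∷ ds) c = trans
  (Σ±ₚ-+ false (suc k) (λ ss → c (signedDescentsD (false ∷ ds) (true ∷ ss))))
  (sum-signedDescents ds (λ J → c (head J ∷ J)))
sum-signedDescentsD (true ∷ ds) c = cong₂ _+ℚ_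
  (sumₚ-signedDescents true ds (λ J → c (true ∷ false ∷ J)))
  (sumₚ-signedDescents false ds (λ J → c (false ∷ true ∷ J)))

ψ-descent : (c : Vec Bool (suc (suc m)) → ℚ) (w : Word (suc (suc m))) → IsPerm w →
  ψ (λ w s → c (desSetD w s)) w ≡ peakSumD (peakSet w) c
ψ-descent {m} c w p = begin
  sumOver (filterᵇ evenSigns (subsets (suc (suc m)))) (λ s → c (desSetD w s))
    ≡⟨ sumOver-evenSigns (suc (suc m)) (λ s → c (desSetD w s)) ⟩
  Σ±ₚ false (suc (suc m)) (λ s → c (desSetD w s))
    ≡⟨ Σ±ₚ-cong false (suc (suc m)) (λ s → cong c (desSetD≡ w s p)) ⟩
  Σ±ₚ false (suc (suc m)) (λ s → c (signedDescentsD (desSetA w) s))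
    ≡⟨ sum-signedDescentsD (desSetA w) c ⟩
  peakSumD (peaks false (desSetA w)) c
    ≡⟨ cong (λ F → peakSumD F c) (peakSet≡peaks w p) ⟨
  peakSumD (peakSet w) c ∎

-- A right inverse of peakSumV by Möbius inversion over the positions at which
-- membership in J changes; b is the membership of the position before J.
unpeak     : Bool → (Vec Bool k → ℚ) → Vec Bool k → ℚ
unpeakStep : Bool → Bool → (Vec Bool (suc k) → ℚ) → Vec Bool k → ℚ

unpeak b d []       = d []
unpeak b d (b′ ∷ J) = unpeak b′ (unpeakStep b b′ d) J

unpeakStep true  true  d F = d (false ∷ F) -ℚ ½ *ℚ d (true ∷ F)
unpeakStep true  false d F = ½ *ℚ d (true ∷ F)
unpeakStep false true  d F = ½ *ℚ d (true ∷ F)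
unpeakStep false false d F = d (false ∷ F) -ℚ ½ *ℚ d (true ∷ F)

-- At a position that is no peak both memberships are summed, and the correction terms for the peak
-- cancel.
unpeakStep-+ : (b : Bool) (d : Vec Bool (suc k) → ℚ) (F : Vec Bool k) →
  unpeakStep b true d F +ℚ unpeakStep b false d F ≡ d (false ∷ F)
unpeakStep-+ true  d F = solve 2 (λ x y → (x :- y) :+ y := x) refl (d (false ∷ F)) (½ *ℚ d (true ∷ F))
  where open +-*-Solver
unpeakStep-+ false d F = solve 2 (λ x y → y :+ (x :- y) := x) refl (d (false ∷ F)) (½ *ℚ d (true ∷ F))
  where open +-*-Solver

-- The factor ½ that `unpeakStep` gives to a change of membership cancels the doubling of `peakSumB`
-- at a peak.
half-sum : ∀ x y → (½ *ℚ x +ℚ ½ *ℚ y) +ℚ (½ *ℚ x +ℚ ½ *ℚ y) ≡ x +ℚ y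
half-sum = solve 2 (λ x y → (con ½ :* x :+ con ½ :* y) :+ (con ½ :* x :+ con ½ :* y) := x :+ y) refl
  where open +-*-Solver

-- The targets `e true` and `e false` may differ, because `unpeakStep b b′` produces a different
-- target for each membership `b′`. The sets have the form `peaks d ds` since `peakSumV` presumes a
-- set that does not begin with a peak.
peakSumB-unpeak : (d : Bool) (ds : Vec Bool k) (c : Vec Bool (suc k) → ℚ) (e : Bool → Vec Bool k → ℚ) →
  (∀ b J → c (b ∷ J) ≡ unpeak b (e b) J) →
  peakSumB (peaks d ds) c ≡ e true (peaks d ds) +ℚ e false (peaks d ds)
peakSumV-unpeak : (ds : Vec Bool k) (b : Bool) (c e : Vec Bool k → ℚ) →
  (∀ J → c J ≡ unpeak b e J) → peakSumV (peaks true ds) c ≡ e (peaks true ds)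
peakSumB-unpeak-nonpeak : (d : Bool) (ds : Vec Bool k) (c : Vec Bool (suc (suc k)) → ℚ)
  (e : Bool → Vec Bool (suc k) → ℚ) → (∀ b J → c (b ∷ J) ≡ unpeak b (e b) J) →
  peakSumB (false ∷ peaks d ds) c ≡ e true (false ∷ peaks d ds) +ℚ e false (false ∷ peaks d ds)

peakSumB-unpeak-nonpeak d ds c e eq = cong₂ _+ℚ_ (branch true) (branch false)
  where
  branch : ∀ b → peakSumB (peaks d ds) (c ∘ (b ∷_)) ≡ e b (false ∷ peaks d ds)
  branch b = trans
    (peakSumB-unpeak d ds (c ∘ (b ∷_)) (λ b′ → unpeakStep b b′ (e b)) (λ b′ J → eq b (b′ ∷ J)))
    (unpeakStep-+ b (e b) (peaks d ds))

peakSumB-unpeak d     []           c e eq = cong₂ _+ℚ_ (eq true []) (eq false [])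
peakSumB-unpeak true  (x ∷ ds)     c e eq = peakSumB-unpeak-nonpeak x ds c e eq
peakSumB-unpeak false (false ∷ ds) c e eq = peakSumB-unpeak-nonpeak false ds c e eq
peakSumB-unpeak false (true ∷ ds)  c e eq = trans
  (cong₂ (λ x y → (x +ℚ y) +ℚ (x +ℚ y))
    (peakSumV-unpeak ds false _ (λ F → ½ *ℚ e true (true ∷ F)) (λ J → eq true (false ∷ J)))
    (peakSumV-unpeak ds true _ (λ F → ½ *ℚ e false (true ∷ F)) (λ J → eq false (true ∷ J))))
  (half-sum (e true (true ∷ peaks true ds)) (e false (true ∷ peaks true ds)))

peakSumV-unpeak []       b c e eq = eq []
peakSumV-unpeak (x ∷ ds) b c e eq = trans
  (peakSumB-unpeak x ds c (λ b′ → unpeakStep b b′ e) (λ b′ J → eq (b′ ∷ J)))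
  (unpeakStep-+ b e (peaks x ds))

-- The two memberships of position 0 contribute additively, so one of them can carry all of `d` and
-- the other nothing.
coeffB : (Vec Bool k → ℚ) → Bool → Vec Bool k → ℚ
coeffB d true  = d
coeffB d false = λ _ → 0ℚ

peakSumB-surjective : (d : Vec Bool k → ℚ) →
  Σ (Vec Bool (suc k) → ℚ) λ c → ∀ ds → peakSumB (peaks false ds) c ≡ d (peaks false ds)
peakSumB-surjective d =
  (λ { (b ∷ J) → unpeak b (coeffB d b) J }) ,
  λ ds → trans (peakSumB-unpeak false ds _ (coeffB d) (λ b J → refl)) (ℚP.+-identityʳ _)

peakSumD-surjective : (d : Vec Bool (suc k) → ℚ) →
  Σ (Vec Bool (suc (suc k)) → ℚ) λ c → ∀ ds → peakSumD (peaks false ds) c ≡ d (peaks false ds)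
peakSumD-surjective {k} d = c , eq
  where
  e : Bool → Vec Bool k → ℚ
  e = coeffB (d ∘ (false ∷_))
  c : Vec Bool (suc (suc k)) → ℚ
  -- Sets in which 1′ and 1 agree enter only for `F` without 1, the others only for `F` containing
  -- 1. The two halves of `d` are therefore treated independently.
  c (true ∷ true ∷ J)   = unpeak true (e true) J
  c (false ∷ false ∷ J) = unpeak false (e false) J
  c (true ∷ false ∷ J)  = unpeak false (d ∘ (true ∷_)) J
  c (false ∷ true ∷ J)  = unpeak true (λ _ → 0ℚ) J
  eq : ∀ ds → peakSumD (peaks false ds) c ≡ d (peaks false ds)
  eq (false ∷ ds) = trans
    (peakSumB-unpeak false ds _ e (λ { true J → refl ; false J → refl }))
    (ℚP.+-identityʳ _)
  eq (true ∷ ds) = trans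
    (cong₂ _+ℚ_ (peakSumV-unpeak ds false _ (d ∘ (true ∷_)) (λ J → refl))
                (peakSumV-unpeak ds true _ (λ _ → 0ℚ) (λ J → refl)))
    (ℚP.+-identityʳ _)

peakAlg⇔φ : (x : QS (suc m)) → InPeakAlg x ⇔ Σ (QB (suc m)) (λ y → InDescentAlgB y × x ≈S φ y)
peakAlg⇔φ {m} x = mk⇔ to from
  where
  to : InPeakAlg x → Σ (QB (suc m)) (λ y → InDescentAlgB y × x ≈S φ y)
  to x∈P@(d , _) with c , eq ← peakSumB-surjective d =
    (λ w s → c (desSetB w s)) ,
    (c , λ w s p → sym (sum-indicator (desSetB w s) c)) ,
    λ w p → begin
      x w                                   ≡⟨ peakAlg-elim x x∈P w p ⟩
      d (peakSet w)                         ≡⟨ cong d (peakSet≡peaks w p) ⟩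
      d (peaks false (desSetA w))           ≡⟨ eq (desSetA w) ⟨
      peakSumB (peaks false (desSetA w)) c  ≡⟨ cong (λ F → peakSumB F c) (peakSet≡peaks w p) ⟨
      peakSumB (peakSet w) c                ≡⟨ φ-descent c w p ⟨
      φ (λ w s → c (desSetB w s)) w         ∎
  from : Σ (QB (suc m)) (λ y → InDescentAlgB y × x ≈S φ y) → InPeakAlg x
  from (y , (c , y≈) , x≈) = peakAlg-intro x (λ F → peakSumB F c) λ w p → begin
    x w                                  ≡⟨ x≈ w p ⟩
    φ y w                                ≡⟨ sumOver-cong (subsets (suc m)) (λ s →
                                              trans (y≈ w s p) (sum-indicator (desSetB w s) c)) ⟩
    φ (λ w s → c (desSetB w s)) w        ≡⟨ φ-descent c w p ⟩
    peakSumB (peakSet w) c               ∎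

ψ-descentAlg : (y : QB (suc m)) ((c , _) : InDescentAlgD y) (w : Word (suc m)) → IsPerm w →
  ψ y w ≡ ψ (λ w s → c (desSetD w s)) w
ψ-descentAlg {m} y (c , y≈) w p =
  sumOver-filter-cong (T? ∘ evenSigns) (subsets (suc m)) λ s even → begin
    y w s
      ≡⟨ y≈ w s p (T⇒true even) ⟩
    sumOver (subsets (suc m)) (λ J → c J *ℚ YD J w s)
      ≡⟨ sumOver-cong (subsets (suc m)) (λ J →
           cong (λ b → c J *ℚ indicator (b ∧ eqBoolVec (desSetD w s) J)) (T⇒true even)) ⟩
    sumOver (subsets (suc m)) (λ J → c J *ℚ indicator (eqBoolVec (desSetD w s) J))
      ≡⟨ sum-indicator (desSetD w s) c ⟩
    c (desSetD w s) ∎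
  where
  T⇒true : ∀ {b} → T b → b ≡ true
  T⇒true {true} _ = refl

descentAlgD-intro : (c : Vec Bool (suc m) → ℚ) → InDescentAlgD (λ w s → c (desSetD w s))
descentAlgD-intro {m} c = c , λ w s p even → begin
  c (desSetD w s)
    ≡⟨ sum-indicator (desSetD w s) c ⟨
  sumOver (subsets (suc m)) (λ J → c J *ℚ indicator (eqBoolVec (desSetD w s) J))
    ≡⟨ sumOver-cong (subsets (suc m)) (λ J →
         cong (λ b → c J *ℚ indicator (b ∧ eqBoolVec (desSetD w s) J)) even) ⟨
  sumOver (subsets (suc m)) (λ J → c J *ℚ YD J w s) ∎

peakAlg⇔ψ : (x : QS (suc m)) → InPeakAlg x ⇔ Σ (QB (suc m)) (λ y → InDescentAlgD y × x ≈S ψ y)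
-- For n = 1 the only even sign vector is the positive one and 1′ is never a descent;
-- `signedDescentsD` needs two letters.
peakAlg⇔ψ {zero} x = mk⇔ to from
  where
  to : InPeakAlg x → Σ (QB 1) (λ y → InDescentAlgD y × x ≈S ψ y)
  to x∈P@(d , _) = (λ w s → d []) , descentAlgD-intro (λ _ → d []) ,
    λ w p → trans (peakAlg-elim x x∈P w p) (sym (ℚP.+-identityʳ (d [])))
  from : Σ (QB 1) (λ y → InDescentAlgD y × x ≈S ψ y) → InPeakAlg x
  from (y , y∈D@(c , _) , x≈) = peakAlg-intro x (λ _ → c (false ∷ [])) λ where
    w@(a ∷ []) p → trans (x≈ w p) (trans (ψ-descentAlg y y∈D w p) (ℚP.+-identityʳ (c (false ∷ []))))
peakAlg⇔ψ {suc m} x = mk⇔ to from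
  where
  to : InPeakAlg x → Σ (QB (suc (suc m))) (λ y → InDescentAlgD y × x ≈S ψ y)
  to x∈P@(d , _) with c , eq ← peakSumD-surjective d =
    (λ w s → c (desSetD w s)) , descentAlgD-intro c ,
    λ w p → begin
      x w                                   ≡⟨ peakAlg-elim x x∈P w p ⟩
      d (peakSet w)                         ≡⟨ cong d (peakSet≡peaks w p) ⟩
      d (peaks false (desSetA w))           ≡⟨ eq (desSetA w) ⟨
      peakSumD (peaks false (desSetA w)) c  ≡⟨ cong (λ F → peakSumD F c) (peakSet≡peaks w p) ⟨
      peakSumD (peakSet w) c                ≡⟨ ψ-descent c w p ⟨
      ψ (λ w s → c (desSetD w s)) w         ∎
  from : Σ (QB (suc (suc m))) (λ y → InDescentAlgD y × x ≈S ψ y) → InPeakAlg x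
  from (y , y∈D@(c , _) , x≈) = peakAlg-intro x (λ F → peakSumD F c) λ w p → begin
    x w                                  ≡⟨ x≈ w p ⟩
    ψ y w                                ≡⟨ ψ-descentAlg y y∈D w p ⟩
    ψ (λ w s → c (desSetD w s)) w        ≡⟨ ψ-descent c w p ⟩
    peakSumD (peakSet w) c               ∎

-- Exchanging adjacent values

swap : Fin m → Fin (suc m) → Fin (suc m)
swap fz     fz          = fs fz
swap fz     (fs fz)     = fz
swap fz     (fs (fs x)) = fs (fs x)
swap (fs a) fz          = fz
swap (fs a) (fs x)      = fs (swap a x)

swap-involutive : (a : Fin m) (x : Fin (suc m)) → swap a (swap a x) ≡ x
swap-involutive fz     fz          = refl
swap-involutive fz     (fs fz)     = refl
swap-involutive fz     (fs (fs x)) = refl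
swap-involutive (fs a) fz          = refl
swap-involutive (fs a) (fs x)      = cong fs (swap-involutive a x)

swap-injective : (a : Fin m) {x y : Fin (suc m)} → swap a x ≡ swap a y → x ≡ y
swap-injective a eq = trans (sym (swap-involutive a _)) (trans (cong (swap a) eq) (swap-involutive a _))

swap-inject₁ : (a : Fin m) → swap a (inject₁ a) ≡ fs a
swap-inject₁ fz     = refl
swap-inject₁ (fs a) = cong fs (swap-inject₁ a)

swap-suc : (a : Fin m) → swap a (fs a) ≡ inject₁ a
swap-suc fz     = refl
swap-suc (fs a) = cong fs (swap-suc a)

swap-other : (a : Fin m) {x : Fin (suc m)} → x ≢ inject₁ a → x ≢ fs a → swap a x ≡ x
swap-other fz     {fz}        x≢ x≢′ = ⊥-elim (x≢ refl)
swap-other fz     {fs fz}     x≢ x≢′ = ⊥-elim (x≢′ refl)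
swap-other fz     {fs (fs x)} x≢ x≢′ = refl
swap-other (fs a) {fz}        x≢ x≢′ = refl
swap-other (fs a) {fs x}      x≢ x≢′ = cong fs (swap-other a (x≢ ∘ cong fs) (x≢′ ∘ cong fs))

swap-below : (a : Fin m) (x : Fin (suc m)) → k ≤ toℕ a →
  toℕ x < k ⊎ toℕ (swap a x) < k → swap a x ≡ x
swap-below a x k≤a lt with x FinP.≟ inject₁ a | x FinP.≟ fs a
... | no x≢    | no x≢′   = swap-other a x≢ x≢′
... | yes refl | _        = ⊥-elim ([ (λ lt → ℕP.≤⇒≯ k≤a (subst (_< _) (FinP.toℕ-inject₁ a) lt))
                                    , (λ lt → ℕP.≤⇒≯ (ℕP.m≤n⇒m≤1+n k≤a) (subst (λ y → toℕ y < _) (swap-inject₁ a) lt)) ] lt)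
... | no _     | yes refl = ⊥-elim ([ ℕP.≤⇒≯ (ℕP.m≤n⇒m≤1+n k≤a)
                                    , (λ lt → ℕP.≤⇒≯ k≤a (subst (_< _) (trans (cong toℕ (swap-suc a)) (FinP.toℕ-inject₁ a)) lt)) ] lt)

Swapped : Fin m → Fin (suc m) → Fin (suc m) → Set
Swapped a x y = (x ≡ inject₁ a × y ≡ fs a) ⊎ (x ≡ fs a × y ≡ inject₁ a)

swapped? : (a : Fin m) (x y : Fin (suc m)) → Dec (Swapped a x y)
swapped? a x y = ((x FinP.≟ inject₁ a) ×-dec (y FinP.≟ fs a)) ⊎-dec ((x FinP.≟ fs a) ×-dec (y FinP.≟ inject₁ a))

swapped-sym : (a : Fin m) {x y : Fin (suc m)} → Swapped a x y → Swapped a y x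
swapped-sym a (inj₁ (p , q)) = inj₂ (q , p)
swapped-sym a (inj₂ (p , q)) = inj₁ (q , p)

swapped-swap : (a : Fin m) {x y : Fin (suc m)} → Swapped a x y → Swapped a (swap a x) (swap a y)
swapped-swap a (inj₁ (refl , refl)) = inj₂ (swap-inject₁ a , swap-suc a)
swapped-swap a (inj₂ (refl , refl)) = inj₁ (swap-suc a , swap-inject₁ a)

-- No value lies strictly between a and a+1, so every other value compares alike with both.
swap-<ᵇ : (a : Fin m) (x y : Fin (suc m)) → ¬ Swapped a x y →
  (toℕ (swap a x) <ᵇ toℕ (swap a y)) ≡ (toℕ x <ᵇ toℕ y)
swap-<ᵇ fz     fz          fz          ¬xy = refl
swap-<ᵇ fz     fz          (fs fz)     ¬xy = ⊥-elim (¬xy (inj₁ (refl , refl)))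
swap-<ᵇ fz     fz          (fs (fs y)) ¬xy = refl
swap-<ᵇ fz     (fs fz)     fz          ¬xy = ⊥-elim (¬xy (inj₂ (refl , refl)))
swap-<ᵇ fz     (fs fz)     (fs fz)     ¬xy = refl
swap-<ᵇ fz     (fs fz)     (fs (fs y)) ¬xy = refl
swap-<ᵇ fz     (fs (fs x)) fz          ¬xy = refl
swap-<ᵇ fz     (fs (fs x)) (fs fz)     ¬xy = refl
swap-<ᵇ fz     (fs (fs x)) (fs (fs y)) ¬xy = refl
swap-<ᵇ (fs a) fz          fz          ¬xy = refl
swap-<ᵇ (fs a) fz          (fs y)      ¬xy = refl
swap-<ᵇ (fs a) (fs x)      fz          ¬xy = refl
swap-<ᵇ (fs a) (fs x)      (fs y)      ¬xy =
  swap-<ᵇ a x y (¬xy ∘ [ (λ (p , q) → inj₁ (cong fs p , cong fs q)) , (λ (p , q) → inj₂ (cong fs p , cong fs q)) ])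

swapValues : Fin m → Vec (Fin (suc m)) k → Vec (Fin (suc m)) k
swapValues a = vmap (swap a)

lookup-swapValues : (a : Fin m) (w : Vec (Fin (suc m)) k) (i : Fin k) → lookup (swapValues a w) i ≡ swap a (lookup w i)
lookup-swapValues a w i = VecP.lookup-map i (swap a) w

swapValues-involutive : (a : Fin m) (w : Vec (Fin (suc m)) k) → swapValues a (swapValues a w) ≡ w
swapValues-involutive a w =
  trans (sym (VecP.map-∘ (swap a) (swap a) w)) (trans (VecP.map-cong (swap-involutive a) w) (VecP.map-id w))

swapValues-injective : (a : Fin m) {v w : Vec (Fin (suc m)) k} → swapValues a v ≡ swapValues a w → v ≡ w
swapValues-injective a eq =
  trans (sym (swapValues-involutive a _)) (trans (cong (swapValues a) eq) (swapValues-involutive a _))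

swapValues-perm : (a : Fin m) (w : Word (suc m)) → IsPerm w → IsPerm (swapValues a w)
swapValues-perm a w p i j eq =
  p i j (swap-injective a (trans (sym (lookup-swapValues a w i)) (trans eq (lookup-swapValues a w j))))

-- Exchanges that preserve the peak set

SwappedAt : Fin m → Word (suc m) → Fin m → Set
SwappedAt a w i = Swapped a (lookup w (inject₁ i)) (lookup w (fs i))

-- Exchanging the values a and a+1 (counted from 0) keeps the peak set unless
-- they are adjacent, and also if they are adjacent but a = 0, except at the
-- first two positions.
Blocked : Fin m → Word (suc m) → Set
Blocked {m} a w = Σ (Fin m) λ i → SwappedAt a w i × (toℕ a ≡ 0 → toℕ i ≡ 0)

blocked? : (a : Fin m) (w : Word (suc m)) → Dec (Blocked a w)
blocked? a w = FinP.any? λ i →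
  swapped? a (lookup w (inject₁ i)) (lookup w (fs i)) ×-dec ((toℕ a ℕP.≟ 0) →-dec (toℕ i ℕP.≟ 0))

blocked-swapValues : (a : Fin m) (w : Word (suc m)) → Blocked a w → Blocked a (swapValues a w)
blocked-swapValues a w (i , sw , c) =
  i , subst₂ (Swapped a) (sym (lookup-swapValues a w (inject₁ i))) (sym (lookup-swapValues a w (fs i))) (swapped-swap a sw) , c

blocked-swapValues⁻¹ : (a : Fin m) (w : Word (suc m)) → Blocked a (swapValues a w) → Blocked a w
blocked-swapValues⁻¹ a w = subst (Blocked a) (swapValues-involutive a w) ∘ blocked-swapValues a (swapValues a w)

descentAt : Word (suc m) → Fin m → Bool
descentAt w i = value w (fs i) <ᵇ value w (inject₁ i)

peakAt : Word (suc m) → Fin m → Bool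
peakAt w fz     = descentAt w fz
peakAt w (fs i) = (value w (inject₁ (inject₁ i)) <ᵇ value w (fs (inject₁ i))) ∧ descentAt w (fs i)

peakSet-tabulate : (w : Word (suc m)) → peakSet w ≡ tabulate (peakAt w)
peakSet-tabulate w = VecP.tabulate-cong λ where
  fz     → cong₂ (λ x y → (0 <ᵇ x) ∧ (y <ᵇ x)) (lookup-vals w fz) (lookup-vals w (fs fz))
  (fs i) → cong₂ _∧_
    (cong₂ _<ᵇ_ (lookup-vals w (inject₁ (inject₁ i))) (lookup-vals w (fs (inject₁ i))))
    (cong₂ _<ᵇ_ (lookup-vals w (fs (fs i))) (lookup-vals w (fs (inject₁ i))))

peakAt-suc : (w : Word (suc (suc m))) → IsPerm w → (i : Fin m) →
  peakAt w (fs i) ≡ not (descentAt w (inject₁ i)) ∧ descentAt w (fs i)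
peakAt-suc w p i =
  cong (_∧ descentAt w (fs i)) (not-<ᵇ (adjacent-distinct w p (inject₁ i) ∘ FinP.toℕ-injective))

descentAt-swapValues : (a : Fin m) (w : Word (suc m)) (i : Fin m) → ¬ SwappedAt a w i →
  descentAt (swapValues a w) i ≡ descentAt w i
descentAt-swapValues a w i ¬sw = trans
  (cong₂ (λ x y → toℕ x <ᵇ toℕ y) (lookup-swapValues a w (fs i)) (lookup-swapValues a w (inject₁ i)))
  (swap-<ᵇ a _ _ (¬sw ∘ swapped-sym a))

ascentAt-swapValues : (a : Fin m) (w : Word (suc m)) (i : Fin m) → ¬ SwappedAt a w i →
  (value (swapValues a w) (inject₁ i) <ᵇ value (swapValues a w) (fs i)) ≡ (value w (inject₁ i) <ᵇ value w (fs i))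
ascentAt-swapValues a w i ¬sw = trans
  (cong₂ (λ x y → toℕ x <ᵇ toℕ y) (lookup-swapValues a w (inject₁ i)) (lookup-swapValues a w (fs i)))
  (swap-<ᵇ a _ _ ¬sw)

-- A peak exceeds two distinct naturals, hence is at least 2.
low-not-peak : ∀ {x y z : ℕ} → y ≤ 1 → x ≢ z → (x <ᵇ y) ∧ (z <ᵇ y) ≡ false
low-not-peak {zero}  {_}         {zero}  _         x≢z = ⊥-elim (x≢z refl)
low-not-peak {zero}  {zero}      {suc z} _         x≢z = refl
low-not-peak {zero}  {suc zero}  {suc z} _         x≢z = refl
low-not-peak {zero}  {suc (suc _)} {suc z} (s≤s ())
low-not-peak {suc x} {zero}              _         x≢z = refl
low-not-peak {suc x} {suc zero}          _         x≢z = refl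
low-not-peak {suc x} {suc (suc _)}       (s≤s ())

swap-≤1 : (a : Fin m) → toℕ a ≡ 0 → {x y : Fin (suc m)} → Swapped a x y → toℕ x ≤ 1 × toℕ y ≤ 1
swap-≤1 fz _ (inj₁ (refl , refl)) = z≤n , ℕP.≤-refl
swap-≤1 fz _ (inj₂ (refl , refl)) = ℕP.≤-refl , z≤n

low-value-not-peak : (w : Word (suc (suc m))) → IsPerm w → (i : Fin m) →
  value w (fs (inject₁ i)) ≤ 1 → peakAt w (fs i) ≡ false
low-value-not-peak w p i y≤1 = low-not-peak y≤1 (apart i ∘ value-injective w p)
  where
  apart : ∀ {m} (i : Fin m) → inject₁ (inject₁ i) ≢ fs (fs i)
  apart fz     ()
  apart (fs i) eq = apart i (FinP.suc-injective eq)

blocked-or-zero : (a : Fin m) (w : Word (suc m)) (i : Fin m) → SwappedAt a w i → ¬ Blocked a w → toℕ a ≡ 0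
blocked-or-zero a w i sw ¬bl = decidable-stable (toℕ a ℕP.≟ 0) (λ a≢0 → ¬bl (i , sw , ⊥-elim ∘ a≢0))

peakAt-swapValues-low : (a : Fin (suc m)) (w : Word (suc (suc m))) → IsPerm w → (i : Fin m) →
  value w (fs (inject₁ i)) ≤ 1 → toℕ (swap a (lookup w (fs (inject₁ i)))) ≤ 1 →
  peakAt (swapValues a w) (fs i) ≡ peakAt w (fs i)
peakAt-swapValues-low a w p i low low′ = trans
  (low-value-not-peak (swapValues a w) (swapValues-perm a w p) i
    (subst (λ x → toℕ x ≤ 1) (sym (lookup-swapValues a w (fs (inject₁ i)))) low′))
  (sym (low-value-not-peak w p i low))

-- At the first position a peak is a descent, and adjacency there is blocked for every `a`.
-- Elsewhere either both comparisons survive, or the values are adjacent; then being unblocked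
-- forces a = 0, and the candidate letter is 0 or 1 before and after, never a peak.
peakAt-swapValues : (a : Fin m) (w : Word (suc m)) → IsPerm w → ¬ Blocked a w →
  ∀ i → peakAt (swapValues a w) i ≡ peakAt w i
peakAt-swapValues a w p ¬bl fz = descentAt-swapValues a w fz (λ sw → ¬bl (fz , sw , λ _ → refl))
peakAt-swapValues a w p ¬bl (fs i)
  with swapped? a (lookup w (inject₁ (inject₁ i))) (lookup w (fs (inject₁ i)))
     | swapped? a (lookup w (inject₁ (fs i))) (lookup w (fs (fs i)))
... | no ¬sw | no ¬sw′ = cong₂ _∧_ (ascentAt-swapValues a w (inject₁ i) ¬sw) (descentAt-swapValues a w (fs i) ¬sw′)
... | yes sw | _       = peakAt-swapValues-low a w p i (proj₂ (swap-≤1 a a≡0 sw)) (proj₂ (swap-≤1 a a≡0 (swapped-swap a sw)))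
  where a≡0 = blocked-or-zero a w (inject₁ i) sw ¬bl
... | no _   | yes sw  = peakAt-swapValues-low a w p i (proj₁ (swap-≤1 a a≡0 sw)) (proj₁ (swap-≤1 a a≡0 (swapped-swap a sw)))
  where a≡0 = blocked-or-zero a w (fs i) sw ¬bl

peakSet-swapValues : (a : Fin m) (w : Word (suc m)) → IsPerm w → ¬ Blocked a w →
  peakSet (swapValues a w) ≡ peakSet w
peakSet-swapValues a w p ¬bl = begin
  peakSet (swapValues a w)                  ≡⟨ peakSet-tabulate (swapValues a w) ⟩
  tabulate (peakAt (swapValues a w))        ≡⟨ VecP.tabulate-cong (peakAt-swapValues a w p ¬bl) ⟩
  tabulate (peakAt w)                       ≡⟨ peakSet-tabulate w ⟨
  peakSet w                                 ∎

-- Connecting permutations with the same peak set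

infix 4 _⟿_
data _⟿_ {m : ℕ} (v : Word (suc m)) : Word (suc m) → Set where
  done : v ⟿ v
  step : ∀ {w} (a : Fin m) → ¬ Blocked a v → swapValues a v ⟿ w → v ⟿ w

⟿-trans : {u v w : Word (suc m)} → u ⟿ v → v ⟿ w → u ⟿ w
⟿-trans done              q = q
⟿-trans (step a ¬bl rest) q = step a ¬bl (⟿-trans rest q)

⟿-perm : {v w : Word (suc m)} → v ⟿ w → IsPerm v → IsPerm w
⟿-perm done                    p = p
⟿-perm {v = v} (step a _ rest) p = ⟿-perm rest (swapValues-perm a v p)

⟿-peakAt : {v w : Word (suc m)} → v ⟿ w → IsPerm v → ∀ i → peakAt w i ≡ peakAt v i
⟿-peakAt done                      p i = refl
⟿-peakAt {v = v} (step a ¬bl rest) p i =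
  trans (⟿-peakAt rest (swapValues-perm a v p) i) (peakAt-swapValues a v p ¬bl i)

SwapInvariant : QS (suc m) → Set
SwapInvariant {m} h = (a : Fin m) (w : Word (suc m)) → IsPerm w → ¬ Blocked a w → h (swapValues a w) ≡ h w

⟿-invariant : (h : QS (suc m)) → SwapInvariant h → {v w : Word (suc m)} → v ⟿ w → IsPerm v → h w ≡ h v
⟿-invariant h inv done                      p = refl
⟿-invariant h inv {v = v} (step a ¬bl rest) p =
  trans (⟿-invariant h inv rest (swapValues-perm a v p)) (inv a v p ¬bl)

Neighbours : Fin (suc m) → Fin (suc m) → Set
Neighbours {m} p q = Σ (Fin m) λ i → (p ≡ inject₁ i × q ≡ fs i) ⊎ (p ≡ fs i × q ≡ inject₁ i)

-- The exchanged values are never adjacent, so all descents are kept and not only the peaks. The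
-- two-sided hypothesis of `unchanged` says that values below `k` neither move nor appear at new
-- positions.
record Lowered (w : Word (suc m)) (p : Fin (suc m)) (k : ℕ) : Set where
  field
    word      : Word (suc m)
    reach     : w ⟿ word
    descents  : ∀ i → descentAt word i ≡ descentAt w i
    lowered   : value word p ≡ k
    unchanged : ∀ i → value w i < k ⊎ value word i < k → lookup word i ≡ lookup w i

-- If every neighbour of p that is smaller than w_p is smaller than k, then
-- the values w_p and w_p − 1 are not adjacent as long as w_p > k.
lower : (w : Word (suc m)) → IsPerm w → (p : Fin (suc m)) (r k : ℕ) → value w p ≡ r + k →
  (∀ q → Neighbours p q → value w q < value w p → value w q < k) → Lowered w p k
lower w perm p zero k wp≡ below = record
  { word = w ; reach = done ; descents = λ _ → refl ; lowered = wp≡ ; unchanged = λ _ _ → refl }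
lower {m} w perm p (suc r) k wp≡ below with lookup w p in eq
... | fs a = record
  { word      = word
  ; reach     = step a (λ (i , sw , _) → ¬adjacent i sw) reach
  ; descents  = λ i → trans (descents i) (descentAt-swapValues a w i (¬adjacent i))
  ; lowered   = lowered
  ; unchanged = λ i → trans-unchanged i
  }
  where
  a≡ : toℕ a ≡ r + k
  a≡ = ℕP.suc-injective wp≡
  k≤a : k ≤ toℕ a
  k≤a = subst (k ≤_) (sym a≡) (ℕP.m≤n+m k r)
  -- A neighbour with value w_p - 1 would be smaller than w_p but not smaller than `k`.
  ¬below : ∀ {q} → Neighbours p q → lookup w q ≢ inject₁ a
  ¬below {q} nb wq = ℕP.≤⇒≯ k≤a (subst (_< k) wq≡a (below q nb (subst (_< _) (sym wq≡a) ℕP.≤-refl)))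
    where
    wq≡a : value w q ≡ toℕ a
    wq≡a = trans (cong toℕ wq) (FinP.toℕ-inject₁ a)
  ¬adjacent : ∀ i → ¬ SwappedAt a w i
  ¬adjacent i (inj₁ (lo , hi)) = ¬below (i , inj₂ (perm _ _ (trans eq (sym hi)) , refl)) lo
  ¬adjacent i (inj₂ (hi , lo)) = ¬below (i , inj₁ (perm _ _ (trans eq (sym hi)) , refl)) lo
  w₁ : Word (suc m)
  w₁ = swapValues a w
  w₁p≡ : value w₁ p ≡ r + k
  w₁p≡ = begin
    value w₁ p                 ≡⟨ cong toℕ (lookup-swapValues a w p) ⟩
    toℕ (swap a (lookup w p))  ≡⟨ cong (toℕ ∘ swap a) eq ⟩
    toℕ (swap a (fs a))        ≡⟨ cong toℕ (swap-suc a) ⟩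
    toℕ (inject₁ a)            ≡⟨ FinP.toℕ-inject₁ a ⟩
    toℕ a                      ≡⟨ a≡ ⟩
    r + k                      ∎
  below₁ : ∀ q → Neighbours p q → value w₁ q < value w₁ p → value w₁ q < k
  below₁ q nb lt = subst (λ x → toℕ x < k) (sym same) (below q nb wq<)
    where
    same : lookup w₁ q ≡ lookup w q
    same = trans (lookup-swapValues a w q) (swap-other a (¬below nb)
      (λ wq → ℕP.<-irrefl (cong (value w₁) (perm q p (trans wq (sym eq)))) lt))
    wq< : value w q < suc (toℕ a)
    wq< = ℕP.m<n⇒m<1+n (subst₂ _<_ (cong toℕ same) (trans w₁p≡ (sym a≡)) lt)
  open Lowered (lower w₁ (swapValues-perm a w perm) p r k w₁p≡ below₁)
  trans-unchanged : ∀ i → value w i < k ⊎ value word i < k → lookup word i ≡ lookup w i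
  trans-unchanged i (inj₁ lt) = trans (unchanged i (inj₁ (subst (λ x → toℕ x < k) (sym same) lt))) same
    where
    same : lookup w₁ i ≡ lookup w i
    same = trans (lookup-swapValues a w i) (swap-below a (lookup w i) k≤a (inj₁ lt))
  trans-unchanged i (inj₂ lt) = trans (unchanged i (inj₂ lt)) (trans (lookup-swapValues a w i)
    (swap-below a (lookup w i) k≤a (inj₂ (subst (λ x → toℕ x < k)
      (trans (unchanged i (inj₂ lt)) (lookup-swapValues a w i)) lt))))

perm-surjective : (w : Word n) → IsPerm w → (k : Fin n) → Σ (Fin n) λ p → lookup w p ≡ k
perm-surjective {suc n} w perm k with FinP.any? (λ p → lookup w p FinP.≟ k)
... | yes found = found
... | no ¬found = ⊥-elim (ℕP.1+n≰n (FinP.injective⇒≤ {f = λ p → punchOut (missed p)}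
                    (λ {p} {q} eq → perm p q (FinP.punchOut-injective (missed p) (missed q) eq))))
  where
  missed : ∀ p → k ≢ lookup w p
  missed p eq = ¬found (p , sym eq)

true⇒< : ∀ {a b} → (a <ᵇ b) ≡ true → a < b
true⇒< {a} {b} eq = ℕP.<ᵇ⇒< a b (subst T (sym eq) _)

<⇒true : ∀ {a b} → a < b → (a <ᵇ b) ≡ true
<⇒true {a} {b} lt with a <ᵇ b | ℕP.<⇒<ᵇ lt
... | true | _ = refl

neighbour-< : (v w : Word (suc m)) → IsPerm v → IsPerm w → (∀ i → descentAt v i ≡ descentAt w i) →
  ∀ {p q} → Neighbours p q → value v q < value v p → value w q < value w p
neighbour-< v w pv pw eq (i , inj₁ (refl , refl)) lt = true⇒< (trans (sym (eq i)) (<⇒true lt))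
neighbour-< v w pv pw eq (i , inj₂ (refl , refl)) lt = true⇒< (begin
  value w (inject₁ i) <ᵇ value w (fs i)   ≡⟨ not-<ᵇ (adjacent-distinct w pw i ∘ FinP.toℕ-injective) ⟩
  not (descentAt w i)                     ≡⟨ cong not (eq i) ⟨
  not (descentAt v i)                     ≡⟨ not-<ᵇ (adjacent-distinct v pv i ∘ FinP.toℕ-injective) ⟨
  value v (inject₁ i) <ᵇ value v (fs i)   ≡⟨ <⇒true lt ⟩
  true                                    ∎)

lookup-ext : (v w : Vec A n) → (∀ i → lookup v i ≡ lookup w i) → v ≡ w
lookup-ext v w eq = trans (sym (VecP.tabulate∘lookup v)) (trans (VecP.tabulate-cong eq) (VecP.tabulate∘lookup w))

-- Moves the values k, k+1, … of w one by one to their positions in w′.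
same-descents⇒⟿ : (w w′ : Word (suc m)) → IsPerm w → IsPerm w′ → (∀ i → descentAt w i ≡ descentAt w′ i) →
  (r k : ℕ) → r + k ≡ suc m → (∀ i → value w i < k ⊎ value w′ i < k → lookup w i ≡ lookup w′ i) → w ⟿ w′
same-descents⇒⟿ w w′ pw pw′ des zero k refl agree
  with refl ← lookup-ext w w′ (λ i → agree i (inj₁ (FinP.toℕ<n (lookup w i)))) = done
same-descents⇒⟿ {m} w w′ pw pw′ des (suc r) k r+k agree =
  ⟿-trans reach (same-descents⇒⟿ word w′ (⟿-perm reach pw) pw′ (λ i → trans (descents i) (des i)) r (suc k)
    (trans (ℕP.+-suc r k) r+k) agree′)
  where
  k<n : k < suc m
  k<n = subst (k <_) r+k (s≤s (ℕP.m≤n+m k r))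
  p : Fin (suc m)
  p = proj₁ (perm-surjective w′ pw′ (fromℕ< k<n))
  w′p≡k : value w′ p ≡ k
  w′p≡k = trans (cong toℕ (proj₂ (perm-surjective w′ pw′ (fromℕ< k<n)))) (FinP.toℕ-fromℕ< k<n)
  k≤wp : k ≤ value w p
  k≤wp = ℕP.≮⇒≥ λ lt → ℕP.<-irrefl (trans (cong toℕ (agree p (inj₁ lt))) w′p≡k) lt
  -- Equal descents make such a `q` smaller than `p` in `w′` too, where `p` has value `k`; so the
  -- value at `q` is already placed and agrees in both words.
  below : ∀ q → Neighbours p q → value w q < value w p → value w q < k
  below q nb lt = subst (λ x → toℕ x < k) (sym (agree q (inj₂ w′q<k))) w′q<k
    where w′q<k = subst (value w′ q <_) w′p≡k (neighbour-< w w′ pw pw′ des nb lt)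
  open Lowered (lower w pw p (value w p ∸ k) k (sym (ℕP.m∸n+n≡m k≤wp)) below)
  at-p : ∀ {i} → i ≡ p → lookup word i ≡ lookup w′ i
  at-p refl = FinP.toℕ-injective (trans lowered (sym w′p≡k))
  agree′ : ∀ i → value word i < suc k ⊎ value w′ i < suc k → lookup word i ≡ lookup w′ i
  agree′ i (inj₁ lt) with ℕP.m<1+n⇒m<n∨m≡n lt
  ... | inj₁ lt′ = trans same (agree i (inj₁ (subst (λ x → toℕ x < k) same lt′)))
    where same = unchanged i (inj₂ lt′)
  ... | inj₂ eq  = at-p (value-injective word (⟿-perm reach pw) (trans eq (sym lowered)))
  agree′ i (inj₂ lt) with ℕP.m<1+n⇒m<n∨m≡n lt
  ... | inj₁ lt′ = trans (unchanged i (inj₁ (subst (λ x → toℕ x < k) (sym same) lt′))) same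
    where same = agree i (inj₂ lt′)
  ... | inj₂ eq  = at-p (value-injective w′ pw′ (trans eq (sym w′p≡k)))

-- Exchanges the values 0 and 1 after moving them to the last two positions of
-- a run of at least two descents, provided the run ends there.
remove-descent : (w : Word (suc (suc m))) → IsPerm w → (j : Fin m) →
  descentAt w (inject₁ j) ≡ true → descentAt w (fs j) ≡ true →
  (∀ i → toℕ i ≡ suc (suc (toℕ j)) → descentAt w i ≡ false) →
  Σ (Word (suc (suc m))) λ w′ → w ⟿ w′ × descentAt w′ (fs j) ≡ false ×
    (∀ i → i ≢ fs j → descentAt w′ i ≡ descentAt w i)
remove-descent {m} w perm j des des′ end =
  swapValues fz w₂ , ⟿-trans L₁.reach (⟿-trans L₂.reach (step fz ¬blocked done)) , removed , others
  where
  b b′ : Fin (suc (suc m))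
  b  = inject₁ (fs j)
  b′ = fs (fs j)
  -- The run ends at `b′`, so no neighbour is smaller and its value can be lowered to 0.
  valley : ∀ q → Neighbours b′ q → value w q < value w b′ → value w q < 0
  valley q (i , inj₁ (b′≡ , refl)) lt with () ←
    trans (sym (<⇒true (subst (λ x → value w (fs i) < value w x) b′≡ lt)))
          (end i (trans (sym (FinP.toℕ-inject₁ i)) (cong toℕ (sym b′≡))))
  valley q (i , inj₂ (refl , refl)) lt = ⊥-elim (ℕP.<-asym lt (true⇒< des′))
  module L₁ = Lowered (lower w perm b′ (value w b′) 0 (sym (ℕP.+-identityʳ _)) valley)
  w₁ : Word (suc (suc m))
  w₁ = L₁.word
  perm₁ : IsPerm w₁
  perm₁ = ⟿-perm L₁.reach perm
  des₁ : value w₁ b < value w₁ (inject₁ (inject₁ j))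
  des₁ = true⇒< (trans (L₁.descents (inject₁ j)) des)
  b≢0 : 1 ≤ value w₁ b
  b≢0 = subst (_< value w₁ b) L₁.lowered (true⇒< (trans (L₁.descents (fs j)) des′))
  -- The only smaller neighbour of `b` is `b′`, which now has value 0, so `b` can be lowered to 1.
  slope : ∀ q → Neighbours b q → value w₁ q < value w₁ b → value w₁ q < 1
  slope q (i , inj₁ (b≡ , refl)) lt with refl ← FinP.inject₁-injective b≡ = subst (_< 1) (sym L₁.lowered) ℕP.≤-refl
  slope q (i , inj₂ (b≡ , refl)) lt with refl ← FinP.suc-injective b≡ = ⊥-elim (ℕP.<-asym lt des₁)
  module L₂ = Lowered (lower w₁ perm₁ b (value w₁ b ∸ 1) 1 (sym (ℕP.m∸n+n≡m b≢0)) slope)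
  w₂ : Word (suc (suc m))
  w₂ = L₂.word
  perm₂ : IsPerm w₂
  perm₂ = ⟿-perm L₂.reach perm₁
  at-b : lookup w₂ b ≡ fs fz
  at-b = FinP.toℕ-injective L₂.lowered
  at-b′ : lookup w₂ b′ ≡ fz
  at-b′ = FinP.toℕ-injective (trans (cong toℕ (L₂.unchanged b′ (inj₁ (subst (_< 1) (sym L₁.lowered) ℕP.≤-refl)))) L₁.lowered)
  -- For the values 0 and 1 only the first two positions block, and `b′` is the third position at
  -- the earliest.
  ¬blocked : ¬ Blocked fz w₂
  ¬blocked (i , sw , i≡0) with FinP.toℕ-injective {j = fz} (i≡0 refl)
  ¬blocked (fz , inj₁ (x , _) , _) | refl with () ← perm₂ _ b′ (trans x (sym at-b′))
  ¬blocked (fz , inj₂ (_ , y) , _) | refl with () ← perm₂ _ b′ (trans y (sym at-b′))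
  removed : descentAt (swapValues fz w₂) (fs j) ≡ false
  removed = cong₂ (λ x y → toℕ x <ᵇ toℕ y)
    (trans (lookup-swapValues fz w₂ b′) (cong (swap fz) at-b′))
    (trans (lookup-swapValues fz w₂ b) (cong (swap fz) at-b))
  others : ∀ i → i ≢ fs j → descentAt (swapValues fz w₂) i ≡ descentAt w i
  others i i≢ = trans (descentAt-swapValues fz w₂ i ¬sw) (trans (L₂.descents i) (L₁.descents i))
    where
    ¬sw : ¬ SwappedAt fz w₂ i
    -- The order 0, 1 would place `b′` directly before `b`, but it stands directly after.
    ¬sw (inj₁ (x , y)) = ℕP.m≢1+n+m (toℕ j) {1} (ℕP.suc-injective (begin
      suc (toℕ j)              ≡⟨ FinP.toℕ-inject₁ (fs j) ⟨
      toℕ b                    ≡⟨ cong toℕ (perm₂ (fs i) b (trans y (sym at-b))) ⟨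
      suc (toℕ i)              ≡⟨ cong suc (FinP.toℕ-inject₁ i) ⟨
      suc (toℕ (inject₁ i))    ≡⟨ cong (suc ∘ toℕ) (perm₂ (inject₁ i) b′ (trans x (sym at-b′))) ⟩
      suc (toℕ b′)             ∎))
    ¬sw (inj₂ (x , y)) = i≢ (FinP.suc-injective (perm₂ (fs i) b′ (trans y (sym at-b′))))

record PeakDescents (w : Word (suc m)) (t : ℕ) : Set where
  field
    word     : Word (suc m)
    reach    : w ⟿ word
    descents : ∀ i → t ≤ toℕ i → descentAt word i ≡ peakAt word i

-- Descents that are not peaks are removed from right to left, so that each is
-- the end of its run when its turn comes.
peakDescents : (w : Word (suc m)) → IsPerm w → (r t : ℕ) → r + t ≡ m → PeakDescents w t
peakDescents w perm zero t refl = record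
  { word = w ; reach = done ; descents = λ i t≤i → ⊥-elim (ℕP.≤⇒≯ t≤i (FinP.toℕ<n i)) }
peakDescents {m} w perm (suc r) t r+t = go (fromℕ< t<m) (FinP.toℕ-fromℕ< t<m)
  where
  t<m : t < m
  t<m = subst (t <_) r+t (s≤s (ℕP.m≤n+m t r))
  open PeakDescents (peakDescents w perm r (suc t) (trans (ℕP.+-suc r t) r+t))
  perm′ : IsPerm word
  perm′ = ⟿-perm reach perm
  with-descents : (w′ : Word (suc m)) → word ⟿ w′ → (i : Fin m) → toℕ i ≡ t →
    (∀ l → l ≢ i → descentAt w′ l ≡ descentAt word l) → descentAt w′ i ≡ peakAt w′ i → PeakDescents w t
  with-descents w′ reach′ i refl others at-i = record
    { word = w′ ; reach = ⟿-trans reach reach′ ; descents = descents′ }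
    where
    descents′ : ∀ l → t ≤ toℕ l → descentAt w′ l ≡ peakAt w′ l
    descents′ l t≤l with l FinP.≟ i
    ... | yes refl = at-i
    ... | no l≢i   = begin
      descentAt w′ l    ≡⟨ others l l≢i ⟩
      descentAt word l  ≡⟨ descents l (ℕP.≤∧≢⇒< t≤l (l≢i ∘ sym ∘ FinP.toℕ-injective)) ⟩
      peakAt word l     ≡⟨ ⟿-peakAt reach′ perm′ l ⟨
      peakAt w′ l       ∎
  no-descent : ∀ {m} (w : Word (suc (suc m))) → IsPerm w → (j : Fin m) →
    descentAt w (fs j) ≡ false → descentAt w (fs j) ≡ peakAt w (fs j)
  no-descent w p j eq = trans eq (sym (trans (peakAt-suc w p j)
    (trans (cong (not (descentAt w (inject₁ j)) ∧_) eq) (BoolP.∧-zeroʳ _))))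
  after-descent : ∀ {m} (w : Word (suc (suc m))) → IsPerm w → (j : Fin m) → descentAt w (fs j) ≡ true →
    (i : Fin (suc m)) → toℕ i ≡ suc (suc (toℕ j)) → peakAt w i ≡ false
  after-descent w p j des (fs i) i≡ with i≡j ← FinP.toℕ-injective {i = inject₁ i} {fs j}
      (trans (FinP.toℕ-inject₁ i) (ℕP.suc-injective i≡)) =
    trans (peakAt-suc w p i) (cong (λ d → not d ∧ descentAt w (fs i)) (trans (cong (descentAt w) i≡j) des))
  go : (i : Fin m) → toℕ i ≡ t → PeakDescents w t
  go fz     i≡t = with-descents word done fz i≡t (λ _ _ → refl) refl
  go (fs j) i≡t with descentAt word (inject₁ j) in des | descentAt word (fs j) in des′
  ... | false | _     = with-descents word done (fs j) i≡t (λ _ _ → refl) (sym (trans (peakAt-suc word perm′ j)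
                          (cong (λ d → not d ∧ descentAt word (fs j)) des)))
  ... | true  | false = with-descents word done (fs j) i≡t (λ _ _ → refl) (no-descent word perm′ j des′)
  -- Position t+1 follows a descent, so it is no peak and, by the invariant, no descent: the run
  -- ends as `remove-descent` requires.
  ... | true  | true
    with w′ , reach′ , removed , others ← remove-descent word perm′ j des des′ (λ i i≡ → trans
           (descents i (ℕP.≤-reflexive (trans (cong suc (sym i≡t)) (sym i≡))))
           (after-descent word perm′ j des′ i i≡))
    = with-descents w′ reach′ (fs j) i≡t others (no-descent w′ (⟿-perm reach′ perm′) j removed)

-- Both permutations reach one whose descents are exactly its peaks.
swapInvariant-peakSet : (h : QS (suc m)) → SwapInvariant h → (v w : Word (suc m)) → IsPerm v → IsPerm w →
  peakSet v ≡ peakSet w → h v ≡ h w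
swapInvariant-peakSet {m} h inv v w pv pw eq = begin
  h v        ≡⟨ ⟿-invariant h inv V.reach pv ⟨
  h V.word   ≡⟨ ⟿-invariant h inv path (⟿-perm V.reach pv) ⟨
  h W.word   ≡⟨ ⟿-invariant h inv W.reach pw ⟩
  h w        ∎
  where
  module V = PeakDescents (peakDescents v pv m 0 (ℕP.+-identityʳ m))
  module W = PeakDescents (peakDescents w pw m 0 (ℕP.+-identityʳ m))
  peakAt≡ : ∀ i → peakAt v i ≡ peakAt w i
  peakAt≡ i = begin
    peakAt v i                       ≡⟨ VecP.lookup∘tabulate (peakAt v) i ⟨
    lookup (tabulate (peakAt v)) i   ≡⟨ cong (λ F → lookup F i) (peakSet-tabulate v) ⟨
    lookup (peakSet v) i             ≡⟨ cong (λ F → lookup F i) eq ⟩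
    lookup (peakSet w) i             ≡⟨ cong (λ F → lookup F i) (peakSet-tabulate w) ⟩
    lookup (tabulate (peakAt w)) i   ≡⟨ VecP.lookup∘tabulate (peakAt w) i ⟩
    peakAt w i                       ∎
  path : V.word ⟿ W.word
  path = same-descents⇒⟿ V.word W.word (⟿-perm V.reach pv) (⟿-perm W.reach pw)
    (λ i → begin
      descentAt V.word i   ≡⟨ V.descents i z≤n ⟩
      peakAt V.word i      ≡⟨ ⟿-peakAt V.reach pv i ⟩
      peakAt v i           ≡⟨ peakAt≡ i ⟩
      peakAt w i           ≡⟨ ⟿-peakAt W.reach pw i ⟨
      peakAt W.word i      ≡⟨ W.descents i z≤n ⟨
      descentAt W.word i   ∎)
    (suc m) 0 (ℕP.+-identityʳ (suc m)) (λ i → [ (λ ()) , (λ ()) ])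

-- Invariant functions and the unit

∈-allVecs : (xs : List A) → (∀ x → x ∈ xs) → (v : Vec A k) → v ∈ allVecs k xs
∈-allVecs xs all []      = here refl
∈-allVecs xs all (x ∷ v) = ∈-concatMap⁺ _ (lose (all x) (∈-map⁺ (x ∷_) (∈-allVecs xs all v)))

∈-perms : (w : Word n) → IsPerm w → w ∈ perms n
∈-perms w p = ∈-filter⁺ isPerm? (∈-allVecs _ ∈-allFin w) p

-- The coefficient at `F` is the value of `h` at some permutation with peak set `F`, found by
-- search; any other choice gives the same value. Sets that are no peak set get the default 0.
swapInvariant⇒peakAlg : (h : QS (suc m)) → SwapInvariant h → InPeakAlg h
swapInvariant⇒peakAlg {m} h inv = peakAlg-intro h d eq
  where
  HasPeakSet : Vec Bool m → Word (suc m) → Set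
  HasPeakSet F w = peakSet w ≡ F
  representative? : ∀ F → Dec (Any (HasPeakSet F) (perms (suc m)))
  representative? F = any? (λ w → VecP.≡-dec BoolP._≟_ (peakSet w) F) (perms (suc m))
  d : Vec Bool m → ℚ
  d F with representative? F
  ... | yes found = h (proj₁ (find found))
  ... | no _      = 0ℚ
  eq : ∀ w → IsPerm w → h w ≡ d (peakSet w)
  eq w p with representative? (peakSet w)
  ... | yes found = let v , v∈ , same = find found in
    swapInvariant-peakSet h inv w v p (proj₂ (∈-filter⁻ isPerm? {xs = allVecs (suc m) (allFin (suc m))} v∈)) (sym same)
  ... | no ¬found = ⊥-elim (¬found (lose (∈-perms w p) refl))

identity-blocked : (a : Fin m) → Blocked a (identityPerm (suc m))
identity-blocked a = a , inj₁ (VecP.lookup-allFin (inject₁ a) , VecP.lookup-allFin (fs a)) , id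

-- Every exchange is blocked at the identity, and blockedness is symmetric, so an allowed move
-- neither starts nor ends there and both values are 0.
oneS∈peakAlg : InPeakAlg (oneS (suc m))
oneS∈peakAlg {m} = swapInvariant⇒peakAlg (oneS (suc m)) λ a w p ¬bl → cong indicator (trans
  (dec-false (VecP.≡-dec FinP._≟_ (swapValues a w) (identityPerm (suc m)))
    (λ eq → ¬bl (blocked-swapValues⁻¹ a w (subst (Blocked a) (sym eq) (identity-blocked a)))))
  (sym (dec-false (VecP.≡-dec FinP._≟_ w (identityPerm (suc m)))
    (λ eq → ¬bl (subst (Blocked a) (sym eq) (identity-blocked a))))))

-- Closure under multiplication

sumOver-tabulate-swap : (a : Fin m) (f : Fin (suc m) → A) (g : A → ℚ) →
  sumOver (List.tabulate (f ∘ swap a)) g ≡ sumOver (List.tabulate f) g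
sumOver-tabulate-swap fz     f g = lem (g (f (fs fz))) (g (f fz)) (sumOver (List.tabulate (f ∘ fs ∘ fs)) g)
  where
  open +-*-Solver
  lem : ∀ x y z → x +ℚ (y +ℚ z) ≡ y +ℚ (x +ℚ z)
  lem = solve 3 (λ x y z → x :+ (y :+ z) := y :+ (x :+ z)) refl
sumOver-tabulate-swap (fs a) f g = cong (g (f fz) +ℚ_) (sumOver-tabulate-swap a (f ∘ fs) g)

sumOver-allFin-swap : (a : Fin m) (g : Fin (suc m) → ℚ) →
  sumOver (allFin (suc m)) (g ∘ swap a) ≡ sumOver (allFin (suc m)) g
sumOver-allFin-swap {m} a g = begin
  sumOver (allFin (suc m)) (g ∘ swap a)          ≡⟨ sumOver-map (swap a) (allFin (suc m)) g ⟨
  sumOver (map (swap a) (allFin (suc m))) g      ≡⟨ cong (λ xs → sumOver xs g) (ListP.map-tabulate id (swap a)) ⟩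
  sumOver (List.tabulate (swap a)) g             ≡⟨ sumOver-tabulate-swap a id g ⟩
  sumOver (allFin (suc m)) g                     ∎

sumOver-allVecs-swap : (k : ℕ) (a : Fin m) (f : Vec (Fin (suc m)) k → ℚ) →
  sumOver (allVecs k (allFin (suc m))) (f ∘ swapValues a) ≡ sumOver (allVecs k (allFin (suc m))) f
sumOver-allVecs-swap zero    a f = refl
sumOver-allVecs-swap {m} (suc k) a f = begin
  sumOver (allVecs (suc k) xs) (f ∘ swapValues a)
    ≡⟨ sumOver-allVecs k xs (f ∘ swapValues a) ⟩
  sumOver xs (λ x → sumOver (allVecs k xs) (λ v → f (swap a x ∷ swapValues a v)))
    ≡⟨ sumOver-cong xs (λ x → sumOver-allVecs-swap k a (f ∘ (swap a x ∷_))) ⟩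
  sumOver xs (λ x → sumOver (allVecs k xs) (λ v → f (swap a x ∷ v)))
    ≡⟨ sumOver-allFin-swap a (λ x → sumOver (allVecs k xs) (λ v → f (x ∷ v))) ⟩
  sumOver xs (λ x → sumOver (allVecs k xs) (λ v → f (x ∷ v)))
    ≡⟨ sumOver-allVecs k xs f ⟨
  sumOver (allVecs (suc k) xs) f ∎
  where xs = allFin (suc m)

does-⇔ : {P Q : Set} (P? : Dec P) (Q? : Dec Q) → (P → Q) → (Q → P) → does P? ≡ does Q?
does-⇔ P? Q? to from with P?
... | yes p = sym (dec-true Q? (to p))
... | no ¬p = sym (dec-false Q? (¬p ∘ from))

-- Exchanging values permutes the letters in each coordinate, hence all words, and it preserves the
-- condition that selects permutations.
sumOver-perms-swap : (a : Fin m) (f : Word (suc m) → ℚ) →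
  sumOver (perms (suc m)) (f ∘ swapValues a) ≡ sumOver (perms (suc m)) f
sumOver-perms-swap {m} a f = begin
  sumOver (perms (suc m)) (f ∘ swapValues a)
    ≡⟨ sumOver-filter isPerm? words (f ∘ swapValues a) ⟩
  sumOver words (λ w → if does (isPerm? w) then f (swapValues a w) else 0ℚ)
    ≡⟨ sumOver-cong words (λ w → cong (λ b → if b then f (swapValues a w) else 0ℚ)
         (does-⇔ (isPerm? w) (isPerm? (swapValues a w)) (swapValues-perm a w)
           (subst IsPerm (swapValues-involutive a w) ∘ swapValues-perm a (swapValues a w)))) ⟩
  sumOver words (λ w → if does (isPerm? (swapValues a w)) then f (swapValues a w) else 0ℚ)
    ≡⟨ sumOver-allVecs-swap (suc m) a (λ w → if does (isPerm? w) then f w else 0ℚ) ⟩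
  sumOver words (λ w → if does (isPerm? w) then f w else 0ℚ)
    ≡⟨ sumOver-filter isPerm? words f ⟨
  sumOver (perms (suc m)) f ∎
  where words = allVecs (suc m) (allFin (suc m))

sumOver-perms-cong : {f g : Word n → ℚ} → (∀ w → IsPerm w → f w ≡ g w) → sumOver (perms n) f ≡ sumOver (perms n) g
sumOver-perms-cong {n} = sumOver-filter-cong isPerm? (allVecs n (allFin n))

compose-swapValuesˡ : (a : Fin m) (u v : Word (suc m)) → compose (swapValues a u) v ≡ swapValues a (compose u v)
compose-swapValuesˡ a u v = trans (VecP.map-cong (lookup-swapValues a u) v) (VecP.map-∘ (swap a) (lookup u) v)

-- Conjugation: `u` carries the transposition of b and b+1 to that of their images, which are a and
-- a+1.
compose-swapValuesʳ : (a b : Fin m) (u v : Word (suc m)) → IsPerm u → SwappedAt a u b →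
  compose u (swapValues b v) ≡ swapValues a (compose u v)
compose-swapValuesʳ a b u v p sw =
  trans (sym (VecP.map-∘ (lookup u) (swap b) v)) (trans (VecP.map-cong commute v) (VecP.map-∘ (swap a) (lookup u) v))
  where
  at-b : Swapped a (lookup u (inject₁ b)) (lookup u (fs b)) →
    lookup u (fs b) ≡ swap a (lookup u (inject₁ b)) × lookup u (inject₁ b) ≡ swap a (lookup u (fs b))
  at-b (inj₁ (x , y)) =
    trans y (sym (trans (cong (swap a) x) (swap-inject₁ a))) , trans x (sym (trans (cong (swap a) y) (swap-suc a)))
  at-b (inj₂ (x , y)) =
    trans y (sym (trans (cong (swap a) x) (swap-suc a))) , trans x (sym (trans (cong (swap a) y) (swap-inject₁ a)))
  avoid : Swapped a (lookup u (inject₁ b)) (lookup u (fs b)) → ∀ {x} → x ≢ inject₁ b → x ≢ fs b →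
    lookup u x ≡ swap a (lookup u x)
  avoid (inj₁ (lo , hi)) x≢ x≢′ =
    sym (swap-other a (λ eq → x≢ (p _ _ (trans eq (sym lo)))) (λ eq → x≢′ (p _ _ (trans eq (sym hi)))))
  avoid (inj₂ (hi , lo)) x≢ x≢′ =
    sym (swap-other a (λ eq → x≢′ (p _ _ (trans eq (sym lo)))) (λ eq → x≢ (p _ _ (trans eq (sym hi)))))
  commute : ∀ x → lookup u (swap b x) ≡ swap a (lookup u x)
  commute x with x FinP.≟ inject₁ b | x FinP.≟ fs b
  ... | yes refl | _        = trans (cong (lookup u) (swap-inject₁ b)) (proj₁ (at-b sw))
  ... | no _     | yes refl = trans (cong (lookup u) (swap-suc b)) (proj₂ (at-b sw))
  ... | no x≢    | no x≢′   = trans (cong (lookup u) (swap-other b x≢ x≢′)) (avoid sw x≢ x≢′)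

-- Values b, b+1 adjacent in `v` become a, a+1 at the same positions of the product. The clauses on
-- the value 0 chain from a to b to the position, so a move allowed on the product is allowed on
-- `v`.
blocked-compose : (a b : Fin m) (u v : Word (suc m)) → SwappedAt a u b → (toℕ a ≡ 0 → toℕ b ≡ 0) →
  Blocked b v → Blocked a (compose u v)
blocked-compose a b u v sw a⇒b (i , sw′ , b⇒i) =
  i , subst₂ (Swapped a) (sym (VecP.lookup-map (inject₁ i) (lookup u) v)) (sym (VecP.lookup-map (fs i) (lookup u) v))
        (image sw′)
    , b⇒i ∘ a⇒b
  where
  image : ∀ {x y} → Swapped b x y → Swapped a (lookup u x) (lookup u y)
  image (inj₁ (refl , refl)) = sw
  image (inj₂ (refl , refl)) = swapped-sym a sw

peakAlg⇒swapInvariant : (x : QS (suc m)) → InPeakAlg x → SwapInvariant x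
peakAlg⇒swapInvariant x x∈P@(d , _) a w p ¬bl = begin
  x (swapValues a w)             ≡⟨ peakAlg-elim x x∈P (swapValues a w) (swapValues-perm a w p) ⟩
  d (peakSet (swapValues a w))   ≡⟨ cong d (peakSet-swapValues a w p ¬bl) ⟩
  d (peakSet w)                  ≡⟨ peakAlg-elim x x∈P w p ⟨
  x w                            ∎

-- Exchanging a and a+1 in w = u v is matched by exchanging them in u if u
-- allows it; otherwise they stand at adjacent positions b, b+1 of u, and
-- exchanging b and b+1 in v has the same effect and is allowed there.
*S-swapInvariant : (x y : QS (suc m)) → SwapInvariant x → SwapInvariant y → SwapInvariant (x *S y)
*S-swapInvariant {m} x y x-inv y-inv a w w-perm ¬bl = begin
  sumOver (perms (suc m)) (part w⁺)
    ≡⟨ sumOver-if (perms (suc m)) (λ u → does (blocked? a u)) (part w⁺) ⟩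
  sumOver (perms (suc m)) (λ u → ifBlocked u (part w⁺ u)) +ℚ
  sumOver (perms (suc m)) (λ u → unlessBlocked u (part w⁺ u))
    ≡⟨ cong₂ _+ℚ_ (sumOver-perms-cong blocked-part) unblocked-sum ⟩
  sumOver (perms (suc m)) (λ u → ifBlocked u (part w u)) +ℚ
  sumOver (perms (suc m)) (λ u → unlessBlocked u (part w u))
    ≡⟨ sumOver-if (perms (suc m)) (λ u → does (blocked? a u)) (part w) ⟨
  sumOver (perms (suc m)) (part w) ∎
  where
  w⁺ : Word (suc m)
  w⁺ = swapValues a w
  _≟ʷ_ : (u v : Word (suc m)) → Dec (u ≡ v)
  _≟ʷ_ = VecP.≡-dec FinP._≟_
  term : Word (suc m) → Word (suc m) → Word (suc m) → ℚ
  term w u v = if does (compose u v ≟ʷ w) then x u *ℚ y v else 0ℚ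
  part : Word (suc m) → Word (suc m) → ℚ
  part w u = sumOver (perms (suc m)) (term w u)
  ifBlocked unlessBlocked : Word (suc m) → ℚ → ℚ
  ifBlocked     u q = if does (blocked? a u) then q else 0ℚ
  unlessBlocked u q = if does (blocked? a u) then 0ℚ else q
  does-swap : ∀ t t⁺ → t⁺ ≡ swapValues a t → does (t⁺ ≟ʷ w⁺) ≡ does (t ≟ʷ w)
  does-swap t t⁺ refl = does-⇔ (swapValues a t ≟ʷ w⁺) (t ≟ʷ w) (swapValues-injective a) (cong (swapValues a))

  term-blocked : ∀ u → IsPerm u → (b : Fin m) → SwappedAt a u b → (toℕ a ≡ 0 → toℕ b ≡ 0) →
    ∀ v → IsPerm v → term w⁺ u (swapValues b v) ≡ term w u v
  term-blocked u u-perm b sw a⇒b v v-perm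
    rewrite does-swap (compose u v) (compose u (swapValues b v)) (compose-swapValuesʳ a b u v u-perm sw)
    with compose u v ≟ʷ w
  ... | no _     = refl
  ... | yes refl = cong (x u *ℚ_) (y-inv b v v-perm (¬bl ∘ blocked-compose a b u v sw a⇒b))
  blocked-part : ∀ u → IsPerm u → ifBlocked u (part w⁺ u) ≡ ifBlocked u (part w u)
  blocked-part u u-perm with blocked? a u
  ... | no _                 = refl
  -- Here `b` depends on `u`, so `v` is reindexed separately for each `u`.
  ... | yes (b , sw , a⇒b) = begin
    sumOver (perms (suc m)) (term w⁺ u)
      ≡⟨ sumOver-perms-swap b (term w⁺ u) ⟨
    sumOver (perms (suc m)) (term w⁺ u ∘ swapValues b)
      ≡⟨ sumOver-perms-cong (term-blocked u u-perm b sw a⇒b) ⟩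
    sumOver (perms (suc m)) (term w u) ∎

  term-unblocked : ∀ u → IsPerm u → ¬ Blocked a u → ∀ v → term w⁺ (swapValues a u) v ≡ term w u v
  term-unblocked u u-perm ¬bl-u v = cong₂ (λ b q → if b then q *ℚ y v else 0ℚ)
    (does-swap (compose u v) (compose (swapValues a u) v) (compose-swapValuesˡ a u v)) (x-inv a u u-perm ¬bl-u)
  unblocked-part : ∀ u → IsPerm u →
    unlessBlocked (swapValues a u) (part w⁺ (swapValues a u)) ≡ unlessBlocked u (part w u)
  unblocked-part u u-perm
    rewrite does-⇔ (blocked? a (swapValues a u)) (blocked? a u) (blocked-swapValues⁻¹ a u) (blocked-swapValues a u)
    with blocked? a u
  ... | yes _    = refl
  ... | no ¬bl-u = sumOver-cong (perms (suc m)) (term-unblocked u u-perm ¬bl-u)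
  unblocked-sum : sumOver (perms (suc m)) (λ u → unlessBlocked u (part w⁺ u)) ≡
    sumOver (perms (suc m)) (λ u → unlessBlocked u (part w u))
  -- The exchange maps the `u` at which it is allowed to one another, so `u` itself can be reindexed
  -- within this class.
  unblocked-sum = trans (sym (sumOver-perms-swap a (λ u → unlessBlocked u (part w⁺ u))))
    (sumOver-perms-cong unblocked-part)

theorem4p2 : (m : ℕ) →
    ((x : QS (suc m)) → InPeakAlg x → InDescentAlgA x)
    × InPeakAlg (oneS (suc m))
    × ((x y : QS (suc m)) → InPeakAlg x → InPeakAlg y → InPeakAlg (x *S y))
    × ((x : QS (suc m)) →
    InPeakAlg x ⇔ Σ (QB (suc m)) (λ y → InDescentAlgB y × x ≈S φ y))
    × ((x : QS (suc m)) →
    InPeakAlg x ⇔ Σ (QB (suc m)) (λ y → InDescentAlgD y × x ≈S ψ y))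
theorem4p2 m =
  peakAlg⊆descentAlg ,
  oneS∈peakAlg ,
  (λ x y x∈P y∈P → swapInvariant⇒peakAlg (x *S y)
    (*S-swapInvariant x y (peakAlg⇒swapInvariant x x∈P) (peakAlg⇒swapInvariant y y∈P))) ,
  peakAlg⇔φ ,
  peakAlg⇔ψ
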